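{- For any $0<\delta,\theta<1$ there is $n_0$ such that the following holds for all $n\ge n_0$. If $G$ is a digraph on $n$ vertices with $\beta(G) \ge \theta n^2$, then for any $0 \le m \le (1-\delta)\theta n$ there is an integer $\ell$ with $m \le \ell \le m + (5 + \delta) \theta^{ -1/2}$ such that $G$ contains a directed cycle of length $\ell$.
   Context: A digraph has a finite vertex set and a set of ordered pairs of vertices (edges), with no loops or parallel edges. A directed cycle of length $\ell\ge 2$ consists of distinct vertices $v_1,\dots,v_\ell$ with edges $(v_i,v_{i+1})$, $1\le i<\ell$, and $(v_\ell,v_1)$. $\beta(G)$ is the minimum number of edges whose deletion leaves a digraph with no directed cycles.
   Formalization: The parameters δ and θ are taken to be rational numbers, and m is read as a nonnegative integer; the bound ℓ ≤ m + (5+δ)θ^{ -1/2} is stated in the equivalent form (ℓ−m)²θ ≤ (5+δ)². -}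

module Defs where

open import Data.Bool using (Bool; true; false; _∧_; not; T; if_then_else_)
open import Data.Nat using (ℕ; zero; suc; _≤_)
open import Data.Fin using (Fin; zero; suc; inject₁; fromℕ)
open import Data.List using (map; allFin)
open import Data.Nat.ListAction using (sum)
open import Data.Product using (Σ; _×_; ∃)
open import Relation.Binary.PropositionalEquality using (_≡_)
open import Function.Definitions using (Injective)
open import Relation.Nullary using (¬_)
open import Data.Integer using (+_)
import Data.Rational as ℚ
open ℚ using (ℚ)

record Digraph (n : ℕ) : Set where
  field
    adj      : Fin n → Fin n → Bool
    loopless : ∀ v → adj v v ≡ false
open Digraph public

HasCycleRel : {n : ℕ} → (Fin n → Fin n → Bool) → ℕ → Set
HasCycleRel {n} E ℓ =
  Σ ℕ λ k → ℓ ≡ suc k × 1 ≤ k ×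
    Σ (Fin (suc k) → Fin n) λ v →
      Injective _≡_ _≡_ v ×
      (∀ (i : Fin k) → T (E (v (inject₁ i)) (v (suc i)))) ×
      T (E (v (fromℕ k)) (v zero))

HasCycle : {n : ℕ} → Digraph n → ℕ → Set
HasCycle G ℓ = HasCycleRel (adj G) ℓ

Acyclic : {n : ℕ} → (Fin n → Fin n → Bool) → Set
Acyclic E = ∀ ℓ → ¬ HasCycleRel E ℓ

EdgeSubset : {n : ℕ} → Digraph n → Set
EdgeSubset {n} G = Σ (Fin n → Fin n → Bool) λ F → ∀ u v → T (F u v) → T (adj G u v)

count : {n : ℕ} → (Fin n → Fin n → Bool) → ℕ
count {n} F = sum (map (λ u → sum (map (λ v → if F u v then 1 else 0) (allFin n))) (allFin n))

delete : {n : ℕ} → (Fin n → Fin n → Bool) → (Fin n → Fin n → Bool) → Fin n → Fin n → Bool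
delete E F u v = E u v ∧ not (F u v)

IsBeta : {n : ℕ} → Digraph n → ℕ → Set
IsBeta G b =
  (Σ (EdgeSubset G) λ F → count (Data.Product.proj₁ F) ≡ b × Acyclic (delete (adj G) (Data.Product.proj₁ F)))
  × (∀ (F : EdgeSubset G) → Acyclic (delete (adj G) (Data.Product.proj₁ F)) → b ≤ count (Data.Product.proj₁ F))

ℕ→ℚ : ℕ → ℚ
ℕ→ℚ k = + k ℚ./ 1

{-# OPTIONS --safe #-}

-- Call W k-robust if every cut (A , B) of W carries at least 5|A||B|/k² edges from A to B.  Splitting
-- a digraph along sparse cuts costs at most 5n²/(2k²) edges in total, so it suffices to order robust pieces
-- cheaply or to find the cycle there.  In a k-robust W, the set of vertices reached within j steps
-- (each step asking for many in-neighbours, so that paths can be kept simple) has size at least 6j²|W|/(11k²):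
-- consecutive layers l, l′ satisfy l l′ ≳ 5|A||B|/k².  Hence the forward and backward balls of radius k
-- around two vertices meet, even if the forward one starts from the i-th neighbourhood: the two vertices are
-- joined by a simple path with length in any prescribed window of 2k - 1 bounded values.  If k is about (5/2)θ^(-1/2),
-- then 5/(2k²) < θ, so k-robust pieces exist, and they contain the cycles of bounded length.
-- For long cycles, take a q-robust piece W with q large and a k-robust piece inside it.  Two bounded sets dominate
-- almost all of W (by out- and by in-edges); any vertex of the second is connected to any vertex of the first
-- through the k-robust piece, with length tuned to the window.  Outside these bounded sets either there is a set of
-- minimum in-degree s, hence a path on s vertices closing up to the desired cycle, or all vertices can be peeled off
-- at a cost of s edges each, giving a feedback arc set of about s|W| edges.

module Submission where

open import Defs
open import Data.Bool using (Bool; true; false; _∧_; _∨_; not; T; if_then_else_)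
open import Data.Fin using (Fin; zero; suc; inject₁; fromℕ)
open import Data.Nat using (ℕ; zero; suc; z≤n; s≤s; NonZero; >-nonZero)
open import Data.Product using (Σ; ∃; _×_; _,_; proj₁; proj₂)
open import Data.Sum using (_⊎_; inj₁; inj₂; [_,_]′)
open import Data.Empty using (⊥-elim)
open import Relation.Binary.PropositionalEquality using (_≡_; _≢_; refl; sym; trans; cong; cong₂; subst; subst₂)

module Combinatorics where

  open import Data.Bool.Properties using (T-∧; T-∨; T?; not-involutive)
  open import Data.Fin.Properties using (any?; _≟_)
  open import Data.Fin.Subset.Properties using (anySubset?)
  open import Data.List as List using (List; []; _∷_; length; _++_; lookup)
  open import Data.List.Membership.DecPropositional using (_∈?_)
  open import Data.List.Membership.Propositional using (_∈_; _∉_)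
  open import Data.List.Membership.Propositional.Properties using (∈-++⁺ˡ; ∈-++⁺ʳ; ∈-++⁻; ∈-lookup)
  open import Data.List.Properties using (length-++; map-tabulate)
  open import Data.List.Relation.Unary.All using (All; []; _∷_) renaming (tabulate to All-tabulate; lookup to All-lookup)
  open import Data.List.Relation.Unary.Any using (here; there)
  open import Data.List.Relation.Unary.Unique.Propositional using (Unique; []; _∷_)
  import Data.List.Relation.Unary.Unique.Propositional.Properties as Uniq
  open import Data.Nat using (_+_; _*_; _∸_; _≤_; _<_; _≤ᵇ_; _≤?_; _<?_; _/_; _%_)
  open import Data.Nat.DivMod using (m≡m%n+[m/n]*n; m%n<n)
  import Data.Nat.ListAction as ListAction
  open import Data.Nat.Properties hiding (_≟_)
  open import Data.Nat.Tactic.RingSolver using (solve-∀)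
  open import Data.Unit using (tt)
  import Data.Vec as Vec
  open import Data.Vec.Properties using (lookup∘tabulate)
  open import Function using (_∘_; flip; id)
  open import Function.Bundles using (Equivalence)
  open import Relation.Nullary using (¬_; Dec; yes; no; ⌊_⌋)
  open import Relation.Nullary.Decidable using (_×-dec_; ¬?; toWitness; fromWitness)
  open import Algebra.Properties.Semiring.Sum +-*-semiring using (sum; ∑-distrib-+; ∑-comm; *-distribˡ-sum; sum-cong-≗)

  -- Counting vertices and edges

  ∧-intro : ∀ {a b} → T a → T b → T (a ∧ b)
  ∧-intro p q = Equivalence.from T-∧ (p , q)

  ∧-elim : ∀ {a b} → T (a ∧ b) → T a × T b
  ∧-elim = Equivalence.to T-∧

  ∨-introˡ : ∀ {a b} → T a → T (a ∨ b)
  ∨-introˡ p = Equivalence.from T-∨ (inj₁ p)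

  ∨-introʳ : ∀ {a b} → T b → T (a ∨ b)
  ∨-introʳ {a} p = Equivalence.from (T-∨ {a}) (inj₂ p)

  ∨-elim : ∀ {a b} → T (a ∨ b) → T a ⊎ T b
  ∨-elim = Equivalence.to T-∨

  not-intro : ∀ {a} → ¬ T a → T (not a)
  not-intro {true}  ¬p = ⊥-elim (¬p tt)
  not-intro {false} ¬p = tt

  not-elim : ∀ {a} → T (not a) → ¬ T a
  not-elim {true}  ()
  not-elim {false} _ ()

  sum-mono : ∀ {n} {f g : Fin n → ℕ} → (∀ v → f v ≤ g v) → sum f ≤ sum g
  sum-mono {zero}  le = z≤n
  sum-mono {suc n} le = +-mono-≤ (le zero) (sum-mono (le ∘ suc))

  ≤sum : ∀ {n} (f : Fin n → ℕ) v → f v ≤ sum f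
  ≤sum f zero    = m≤m+n _ _
  ≤sum f (suc v) = ≤-trans (≤sum (f ∘ suc) v) (m≤n+m _ (f zero))

  ⟦_⟧ : Bool → ℕ
  ⟦ b ⟧ = if b then 1 else 0

  ⟦⟧-mono : ∀ {a b} → (T a → T b) → ⟦ a ⟧ ≤ ⟦ b ⟧
  ⟦⟧-mono {false}         _ = z≤n
  ⟦⟧-mono {true}  {true}  _ = ≤-refl
  ⟦⟧-mono {true}  {false} p = ⊥-elim (p tt)

  ⟦∨⟧ : ∀ a b → ⟦ a ∨ b ⟧ ≤ ⟦ a ⟧ + ⟦ b ⟧
  ⟦∨⟧ true  b = s≤s z≤n
  ⟦∨⟧ false b = ≤-refl

  ⟦⟧-disjoint : ∀ {a b c} → (T a → T c) → (T b → T c) → (T a → ¬ T b) → ⟦ a ⟧ + ⟦ b ⟧ ≤ ⟦ c ⟧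
  ⟦⟧-disjoint {false}        p q r = ⟦⟧-mono q
  ⟦⟧-disjoint {true} {false} p q r = ⟦⟧-mono p
  ⟦⟧-disjoint {true} {true}  p q r = ⊥-elim (r tt tt)

  VSet : ℕ → Set
  VSet n = Fin n → Bool

  infix 4 _⊑_
  _⊑_ : ∀ {n} → VSet n → VSet n → Set
  A ⊑ B = ∀ v → T (A v) → T (B v)

  infixr 7 _∩_ _∖_
  infixr 6 _∪_
  _∩_ _∪_ _∖_ : ∀ {n} → VSet n → VSet n → VSet n
  (A ∩ B) v = A v ∧ B v
  (A ∪ B) v = A v ∨ B v
  (A ∖ B) v = A v ∧ not (B v)

  ∖-intro : ∀ {n} (A B : VSet n) {v} → T (A v) → ¬ T (B v) → T ((A ∖ B) v)
  ∖-intro A B p q = ∧-intro p (not-intro q)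

  ∖-elim : ∀ {n} (A B : VSet n) {v} → T ((A ∖ B) v) → T (A v) × ¬ T (B v)
  ∖-elim A B p = proj₁ (∧-elim p) , not-elim (proj₂ (∧-elim p))

  opaque

    size : ∀ {n} → VSet n → ℕ
    size A = sum λ v → ⟦ A v ⟧

    size-mono : ∀ {n} {A B : VSet n} → A ⊑ B → size A ≤ size B
    size-mono p = sum-mono λ v → ⟦⟧-mono (p v)

    size-∪ : ∀ {n} (A B : VSet n) → size (A ∪ B) ≤ size A + size B
    size-∪ A B = ≤-trans (sum-mono λ v → ⟦∨⟧ (A v) (B v)) (≤-reflexive (∑-distrib-+ (λ v → ⟦ A v ⟧) (λ v → ⟦ B v ⟧)))

    size-disjoint : ∀ {n} {A B C : VSet n} → A ⊑ C → B ⊑ C → (∀ v → T (A v) → ¬ T (B v)) → size A + size B ≤ size C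
    size-disjoint {A = A} {B} p q r = ≤-trans (≤-reflexive (sym (∑-distrib-+ (λ v → ⟦ A v ⟧) (λ v → ⟦ B v ⟧))))
      (sum-mono λ v → ⟦⟧-disjoint (p v) (q v) (r v))

  size-cover : ∀ {n} {A B C : VSet n} → (∀ v → T (C v) → T (A v) ⊎ T (B v)) → size C ≤ size A + size B
  size-cover {A = A} {B} p = ≤-trans (size-mono {B = A ∪ B} λ v c → [ ∨-introˡ , ∨-introʳ {A v} ]′ (p v c)) (size-∪ A B)

  size-split : ∀ {n} (A B : VSet n) → size (A ∩ B) + size (A ∖ B) ≡ size A
  size-split A B = ≤-antisym
    (size-disjoint {A = A ∩ B} {A ∖ B} {A} (λ v p → proj₁ (∧-elim p)) (λ v p → proj₁ (∖-elim A B p))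
       (λ v p q → proj₂ (∖-elim A B q) (proj₂ (∧-elim {A v} p))))
    (size-cover {A = A ∩ B} {A ∖ B} {A} λ v p → split v p (T? (B v)))
    where
    split : ∀ v → T (A v) → Dec (T (B v)) → T ((A ∩ B) v) ⊎ T ((A ∖ B) v)
    split v p (yes q) = inj₁ (∧-intro p q)
    split v p (no q)  = inj₂ (∖-intro A B p q)

  size-∖ : ∀ {n} (A B : VSet n) → B ⊑ A → size B + size (A ∖ B) ≡ size A
  size-∖ A B sub = trans (cong (_+ size (A ∖ B)) (≤-antisym (size-mono λ v p → ∧-intro (sub v p) p)
                                                         (size-mono λ v p → proj₂ (∧-elim {A v} p))))
                         (size-split A B)

  size-inclusion-exclusion : ∀ {n} {A B W : VSet n} → A ⊑ W → B ⊑ W → size A + size B ≤ size W + size (A ∩ B)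
  size-inclusion-exclusion {A = A} {B} {W} p q = begin
    size A + size B                             ≡⟨ cong (_+ size B) (size-split A B) ⟨
    size (A ∩ B) + size (A ∖ B) + size B        ≡⟨ +-assoc (size (A ∩ B)) _ _ ⟩
    size (A ∩ B) + (size (A ∖ B) + size B)      ≤⟨ +-monoʳ-≤ (size (A ∩ B)) (size-disjoint {A = A ∖ B} {B} {W}
                                                     (λ v r → p v (proj₁ (∖-elim A B r))) q (λ v r → proj₂ (∖-elim A B r))) ⟩
    size (A ∩ B) + size W                       ≡⟨ +-comm (size (A ∩ B)) _ ⟩
    size W + size (A ∩ B) ∎
    where open ≤-Reasoning

  opaque

    unfolding size

    size≤n : ∀ {n} (A : VSet n) → size A ≤ n
    size≤n {zero}  A = z≤n
    size≤n {suc n} A = +-mono-≤ (⟦⟧≤1 (A zero)) (size≤n (A ∘ suc))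
      where
      ⟦⟧≤1 : ∀ b → ⟦ b ⟧ ≤ 1
      ⟦⟧≤1 true  = ≤-refl
      ⟦⟧≤1 false = z≤n

    size-∅ : ∀ {n} {A : VSet n} → (∀ v → ¬ T (A v)) → size A ≡ 0
    size-∅ {zero}  p = refl
    size-∅ {suc n} {A} p = cong₂ _+_ (n≤0⇒n≡0 (⟦⟧-mono {A zero} {false} (p zero))) (size-∅ {n} (p ∘ suc))

    member⇒size : ∀ {n} {A : VSet n} v → T (A v) → 1 ≤ size A
    member⇒size {A = A} v p = ≤-trans (⟦⟧-mono {true} (λ _ → p)) (≤sum (λ u → ⟦ A u ⟧) v)

    size-suc : ∀ {n} (A : VSet (suc n)) → size A ≡ ⟦ A zero ⟧ + size (A ∘ suc)
    size-suc A = refl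

  ⁅_⁆ : ∀ {n} → Fin n → VSet n
  ⁅ x ⁆ v = ⌊ v ≟ x ⌋

  x∈⁅x⁆ : ∀ {n} (x : Fin n) → T (⁅ x ⁆ x)
  x∈⁅x⁆ x = fromWitness {a? = x ≟ x} refl

  ⁅⁆⊑ : ∀ {n} {A : VSet n} {x} → T (A x) → ⁅ x ⁆ ⊑ A
  ⁅⁆⊑ {A = A} p v q = subst (T ∘ A) (sym (toWitness q)) p

  size-⁅⁆ : ∀ {n} (x : Fin n) → size ⁅ x ⁆ ≡ 1
  size-⁅⁆ {n} x = ≤-antisym (≤1 x) (member⇒size x (x∈⁅x⁆ x))
    where
    ≤1 : ∀ {n} (x : Fin n) → size ⁅ x ⁆ ≤ 1
    ≤1 {suc n} zero    = ≤-reflexive (trans (size-suc ⁅ zero ⁆) (cong suc (size-∅ {n} λ v ())))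
    ≤1 {suc n} (suc x) = ≤-trans (≤-reflexive (size-suc ⁅ suc x ⁆)) (≤-trans (size-mono {n} {⁅ suc x ⁆ ∘ suc} {⁅ x ⁆} λ v p → fromWitness {a? = v ≟ x} (suc-inj (toWitness p))) (≤1 x))
      where
      suc-inj : ∀ {n} {i j : Fin n} → suc i ≡ suc j → i ≡ j
      suc-inj refl = refl

  listed : ∀ {n} → List (Fin n) → VSet n
  listed xs v = ⌊ _∈?_ _≟_ v xs ⌋

  size-listed : ∀ {n} (xs : List (Fin n)) → size (listed xs) ≤ length xs
  size-listed {n} []       = ≤-reflexive (size-∅ {n} λ v ())
  size-listed {n} (x ∷ xs) = ≤-trans (size-cover {A = ⁅ x ⁆} {listed xs} λ v p → split v (toWitness p))
                              (+-mono-≤ (≤-reflexive (size-⁅⁆ x)) (size-listed xs))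
    where
    split : ∀ v → v ∈ x ∷ xs → T (⁅ x ⁆ v) ⊎ T (listed xs v)
    split v (here eq)  = inj₁ (fromWitness eq)
    split v (there p)  = inj₂ (fromWitness p)

  -- Pigeonhole: otherwise A would lie inside `listed xs`. All paths below are grown with it, `xs`
  -- being the vertices to dodge.
  pick : ∀ {n} {A : VSet n} xs → length xs < size A → ∃ λ v → T (A v) × v ∉ xs
  pick {A = A} xs lt with any? (λ v → T? (A v) ×-dec ¬? (_∈?_ _≟_ v xs))
  ... | yes found = found
  ... | no  none  = ⊥-elim (<⇒≱ lt (≤-trans (size-mono {B = listed xs} inside) (size-listed xs)))
    where
    inside : ∀ v → T (A v) → T (listed xs v)
    inside v p with _∈?_ _≟_ v xs
    ... | yes _ = tt
    ... | no ∉  = ⊥-elim (none (v , p , ∉))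

  opaque

    pairs : ∀ {n} → (Fin n → Fin n → Bool) → ℕ
    pairs R = sum λ u → size (R u)

    pairs-mono : ∀ {n} {R S : Fin n → Fin n → Bool} → (∀ u v → T (R u v) → T (S u v)) → pairs R ≤ pairs S
    pairs-mono p = sum-mono λ u → size-mono (p u)

    pairs-∪ : ∀ {n} (R S : Fin n → Fin n → Bool) → pairs (λ u v → R u v ∨ S u v) ≤ pairs R + pairs S
    pairs-∪ R S = ≤-trans (sum-mono λ u → size-∪ (R u) (S u)) (≤-reflexive (∑-distrib-+ (size ∘ R) (size ∘ S)))

  pairs-cover₃ : ∀ {n} {R A B C : Fin n → Fin n → Bool} →
    (∀ u v → T (R u v) → T (A u v) ⊎ T (B u v) ⊎ T (C u v)) → pairs R ≤ pairs A + pairs B + pairs C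
  pairs-cover₃ {R = R} {A} {B} {C} p = begin
    pairs R                                                     ≤⟨ pairs-mono {S = λ u v → (A u v ∨ B u v) ∨ C u v} (λ u v r → join u v (p u v r)) ⟩
    pairs (λ u v → (A u v ∨ B u v) ∨ C u v)                     ≤⟨ pairs-∪ (λ u v → A u v ∨ B u v) C ⟩
    pairs (λ u v → A u v ∨ B u v) + pairs C                     ≤⟨ +-monoˡ-≤ (pairs C) (pairs-∪ A B) ⟩
    pairs A + pairs B + pairs C ∎
    where
    open ≤-Reasoning
    join : ∀ u v → T (A u v) ⊎ T (B u v) ⊎ T (C u v) → T ((A u v ∨ B u v) ∨ C u v)
    join u v (inj₁ a)        = ∨-introˡ {A u v ∨ B u v} (∨-introˡ a)
    join u v (inj₂ (inj₁ b)) = ∨-introˡ {A u v ∨ B u v} (∨-introʳ {A u v} b)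
    join u v (inj₂ (inj₂ c)) = ∨-introʳ {A u v ∨ B u v} c

  opaque

    unfolding size pairs

    pairs-flip : ∀ {n} (R : Fin n → Fin n → Bool) → pairs (flip R) ≡ pairs R
    pairs-flip R = ∑-comm λ u v → ⟦ R v u ⟧

    -- Row-by-row double counting. The factor q expresses a rational degree bound t/q without
    -- division.
    *pairs≤*size : ∀ {n} (R : Fin n → Fin n → Bool) (A : VSet n) q t →
      (∀ u v → T (R u v) → T (A u)) → (∀ u → T (A u) → q * size (R u) ≤ t) → q * pairs R ≤ t * size A
    *pairs≤*size R A q t inside le = begin
      q * pairs R                     ≡⟨ *-distribˡ-sum q (λ v → size (R v)) ⟩
      sum (λ v → q * size (R v))      ≤⟨ sum-mono bound ⟩
      sum (λ v → t * ⟦ A v ⟧)         ≡⟨ *-distribˡ-sum t (λ v → ⟦ A v ⟧) ⟨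
      t * size A ∎
      where
      open ≤-Reasoning
      bound : ∀ v → q * size (R v) ≤ t * ⟦ A v ⟧
      bound v with A v | inside v | le v
      ... | true  | _ | p = ≤-trans (p tt) (≤-reflexive (sym (*-identityʳ t)))
      ... | false | p | _ = ≤-trans (≤-reflexive (trans (cong (q *_) (size-∅ p)) (*-zeroʳ q))) z≤n

    *size≤pairs : ∀ {n} (R : Fin n → Fin n → Bool) (A : VSet n) q t → (∀ u → T (A u) → t ≤ q * size (R u)) → t * size A ≤ q * pairs R
    *size≤pairs R A q t ge = begin
      t * size A                      ≡⟨ *-distribˡ-sum t (λ v → ⟦ A v ⟧) ⟩
      sum (λ v → t * ⟦ A v ⟧)         ≤⟨ sum-mono bound ⟩
      sum (λ v → q * size (R v))      ≡⟨ *-distribˡ-sum q (λ v → size (R v)) ⟨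
      q * pairs R ∎
      where
      open ≤-Reasoning
      bound : ∀ v → t * ⟦ A v ⟧ ≤ q * size (R v)
      bound v with A v | ge v
      ... | true  | p = ≤-trans (≤-reflexive (*-identityʳ t)) (p tt)
      ... | false | _ = ≤-trans (≤-reflexive (*-zeroʳ t)) z≤n

  Rel : ℕ → Set
  Rel n = Fin n → Fin n → Bool

  -- In-degrees are written `outdeg (flip E)`, so that each argument about out-edges also serves
  -- in-edges.
  outdeg : ∀ {n} → Rel n → VSet n → Fin n → ℕ
  outdeg E B u = size λ v → B v ∧ E u v

  edges : ∀ {n} → Rel n → VSet n → VSet n → ℕ
  edges E A B = pairs λ u v → A u ∧ B v ∧ E u v

  module _ {n} (E : Rel n) where

    edges-flip : ∀ A B → edges (flip E) A B ≡ edges E B A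
    edges-flip A B = trans (sym (pairs-flip λ u v → A u ∧ B v ∧ E v u))
      (≤-antisym (pairs-mono λ u v → swap (A v) (B u) (E u v)) (pairs-mono λ u v → swap (B u) (A v) (E u v)))
      where
      swap : ∀ a b c → T (a ∧ b ∧ c) → T (b ∧ a ∧ c)
      swap true  true  c p = p
      swap true  false c ()
      swap false b     c ()

    edges-mono : ∀ {A A′ B B′} → A ⊑ A′ → B ⊑ B′ → edges E A B ≤ edges E A′ B′
    edges-mono {A} {_} {B} p q = pairs-mono λ u v r →
      let (a , bc) = ∧-elim {A u} r ; (b , c) = ∧-elim {B v} bc in ∧-intro (p u a) (∧-intro (q v b) c)

    *edges≤-outdeg : ∀ A B q t → (∀ u → T (A u) → q * outdeg E B u ≤ t) → q * edges E A B ≤ t * size A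
    *edges≤-outdeg A B q t le = *pairs≤*size _ A q t (λ u v p → proj₁ (∧-elim p))
      λ u a → ≤-trans (*-monoʳ-≤ q (size-mono λ v p → proj₂ (∧-elim {A u} p))) (le u a)

    edges-≤-outdeg : ∀ A B t → (∀ u → T (A u) → outdeg E B u ≤ t) → edges E A B ≤ t * size A
    edges-≤-outdeg A B t le = ≤-trans (≤-reflexive (sym (*-identityˡ (edges E A B))))
      (*edges≤-outdeg A B 1 t λ u a → ≤-trans (≤-reflexive (*-identityˡ (outdeg E B u))) (le u a))

    edges-≥-outdeg : ∀ A B q t → (∀ u → T (A u) → t ≤ q * outdeg E B u) → t * size A ≤ q * edges E A B
    edges-≥-outdeg A B q t ge = *size≤pairs _ A q t λ u a → ≤-trans (ge u a) (*-monoʳ-≤ q (size-mono λ v p → ∧-intro a p))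

    outdeg≤size : ∀ B u → outdeg E B u ≤ size B
    outdeg≤size B u = size-mono λ v p → proj₁ (∧-elim p)

  module _ {n} (E : Rel n) where

    edges-≤-indeg : ∀ A B t → (∀ v → T (B v) → outdeg (flip E) A v ≤ t) → edges E A B ≤ t * size B
    edges-≤-indeg A B t le = ≤-trans (≤-reflexive (edges-flip (flip E) A B)) (edges-≤-outdeg (flip E) B A t le)

    edges-≥-indeg : ∀ A B q t → (∀ v → T (B v) → t ≤ q * outdeg (flip E) A v) → t * size B ≤ q * edges E A B
    edges-≥-indeg A B q t le = ≤-trans (edges-≥-outdeg (flip E) B A q t le) (≤-reflexive (cong (q *_) (sym (edges-flip (flip E) A B))))

    edges≤*size : ∀ A B → edges E A B ≤ size B * size A
    edges≤*size A B = edges-≤-outdeg E A B (size B) λ u _ → outdeg≤size E B u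

  -- Feedback arc sets and sparse cuts

  -- A feedback arc set is encoded by a ranking r: it consists of the edges along which r does not increase.
  back : ∀ {n} → Rel n → VSet n → (Fin n → ℕ) → Rel n
  back E W r u v = W u ∧ W v ∧ E u v ∧ (r v ≤ᵇ r u)

  Fb : ∀ {n} → Rel n → VSet n → ℕ → Set
  Fb {n} E W b = Σ (Fin n → ℕ) λ r → pairs (back E W r) ≤ b

  Robust : ∀ {n} → ℕ → Rel n → VSet n → Set
  Robust {n} k E W = ∀ (S : VSet n) → 5 * (size (W ∩ S) * size (W ∖ S)) ≤ k * k * edges E (W ∩ S) (W ∖ S)

  module _ {n} (E : Rel n) where

    Fb-weaken : ∀ {W b b′} → b ≤ b′ → Fb E W b → Fb E W b′
    Fb-weaken le (r , p) = r , ≤-trans p le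

    Fb-trivial : ∀ W → Fb E W (size W * size W)
    Fb-trivial W = (λ _ → 0) , ≤-trans
      (pairs-mono λ u v p → let (w , q) = ∧-elim {W u} p ; (w′ , q′) = ∧-elim {W v} q in
                            ∧-intro w (∧-intro w′ (proj₁ (∧-elim q′))))
      (edges≤*size E W W)

    -- B is placed before A, so that only the edges from A to B become backward.
    Fb-union : ∀ {W A B a b} → (∀ v → T (W v) → T (A v) ⊎ T (B v)) → Fb E A a → Fb E B b → Fb E W (a + b + edges E A B)
    Fb-union {W} {A} {B} {a} {b} cover (rA , pA) (rB , pB) = r , ≤-trans (pairs-cover₃ classify)
      (+-monoˡ-≤ (edges E A B) (+-mono-≤ pA pB))
      where
      -- Larger than every rank on B, so the vertices outside B all come after it and keep their own
      -- order.
      top = suc (sum rB)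
      r : Fin n → ℕ
      r v = if B v then rB v else top + rA v
      classify : ∀ u v → T (back E W r u v) → T (back E A rA u v) ⊎ T (back E B rB u v) ⊎ T (A u ∧ B v ∧ E u v)
      classify u v p with ∧-elim {W u} p
      ... | wu , p₁ with ∧-elim {W v} p₁
      ... | wv , p₂ with ∧-elim {E u v} p₂
      ... | e , le with B u in bu | B v in bv | cover u wu | cover v wv
      ... | true | true  | _ | _ = inj₂ (inj₁ (∧-intro e le))
      ... | true | false | _ | _ = ⊥-elim (<⇒≱ (s≤s (≤-trans (≤sum rB u) (m≤m+n _ (rA v)))) (≤ᵇ⇒≤ _ _ le))
      ... | false | true | inj₁ au | _ = inj₂ (inj₂ (∧-intro au e))
      ... | false | false | inj₁ au | inj₁ av = inj₁ (∧-intro au (∧-intro av (∧-intro e (≤⇒≤ᵇ (+-cancelˡ-≤ top _ _ (≤ᵇ⇒≤ _ _ le))))))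

    -- An exhaustive search over bit vectors decides the matter. A Boolean function agrees with its
    -- tabulation only pointwise, so the cut is carried over by monotonicity of sizes and edge
    -- counts.
    robust-or-sparse : ∀ k W → Robust k E W ⊎ ∃ λ S → k * k * edges E (W ∩ S) (W ∖ S) < 5 * (size (W ∩ S) * size (W ∖ S))
    robust-or-sparse k W with anySubset? (λ S → k * k * edges E (W ∩ Vec.lookup S) (W ∖ Vec.lookup S) <? 5 * (size (W ∩ Vec.lookup S) * size (W ∖ Vec.lookup S)))
    ... | yes (S , sparse) = inj₂ (Vec.lookup S , sparse)
    ... | no ¬sparse = inj₁ λ S → let
        same : ∀ v → Vec.lookup (Vec.tabulate S) v ≡ S v
        same = lookup∘tabulate S
        to : W ∩ S ⊑ W ∩ Vec.lookup (Vec.tabulate S)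
        to v = subst (λ b → T (W v ∧ b)) (sym (same v))
        to∖ : W ∖ S ⊑ W ∖ Vec.lookup (Vec.tabulate S)
        to∖ v = subst (λ b → T (W v ∧ not b)) (sym (same v))
      in ≤-trans (*-monoʳ-≤ 5 (*-mono-≤ (size-mono to) (size-mono to∖)))
        (≤-trans (≮⇒≥ (λ lt → ¬sparse (Vec.tabulate S , lt)))
          (*-monoʳ-≤ (k * k) (edges-mono E (λ v → subst (λ b → T (W v ∧ b)) (same v)) (λ v → subst (λ b → T (W v ∧ not b)) (same v)))))

    -- Reversing all edges exchanges the two sides of a cut, so the hypothesis is applied to
    -- `not ∘ S`. Double negation cancels only pointwise, hence the inclusions.
    robust-flip : ∀ {k W} → Robust k E W → Robust k (flip E) W
    robust-flip {k} {W} rob S = begin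
      5 * (size (W ∩ S) * size (W ∖ S))                      ≡⟨ cong (5 *_) (*-comm (size (W ∩ S)) _) ⟩
      5 * (size (W ∖ S) * size (W ∩ S))                      ≤⟨ *-monoʳ-≤ 5 (*-monoʳ-≤ (size (W ∖ S)) (size-mono λ v → subst (λ b → T (W v ∧ b)) (sym (not-involutive (S v))))) ⟩
      5 * (size (W ∩ (not ∘ S)) * size (W ∖ (not ∘ S)))      ≤⟨ rob (not ∘ S) ⟩
      k * k * edges E (W ∖ S) (W ∖ (not ∘ S))                ≤⟨ *-monoʳ-≤ (k * k) (edges-mono E {A = W ∖ S} (λ v p → p) λ v → subst (λ b → T (W v ∧ b)) (not-involutive (S v))) ⟩
      k * k * edges E (W ∖ S) (W ∩ S)                        ≡⟨ cong (k * k *_) (edges-flip E (W ∩ S) (W ∖ S)) ⟨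
      k * k * edges (flip E) (W ∩ S) (W ∖ S) ∎
      where open ≤-Reasoning

    robust-cut : ∀ {k W} → Robust k E W → ∀ {A} → A ⊑ W → 5 * (size A * size (W ∖ A)) ≤ k * k * edges E A (W ∖ A)
    robust-cut {k} {W} rob {A} sub = begin
      5 * (size A * size (W ∖ A))             ≤⟨ *-monoʳ-≤ 5 (*-monoˡ-≤ (size (W ∖ A)) (size-mono λ v a → ∧-intro (sub v a) a)) ⟩
      5 * (size (W ∩ A) * size (W ∖ A))       ≤⟨ rob A ⟩
      k * k * edges E (W ∩ A) (W ∖ A)         ≤⟨ *-monoʳ-≤ (k * k) (edges-mono E (λ v p → proj₂ (∧-elim {W v} p)) λ v p → p) ⟩
      k * k * edges E A (W ∖ A) ∎
      where open ≤-Reasoning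

    -- Splitting along sparse cuts costs at most 5|A||B|/k² per cut, and 2|A||B| = (|A|+|B|)² - |A|² - |B|².
    decompose : ∀ k c {Good : Set} W₀ → (∀ W → W ⊑ W₀ → Robust k E W → Good ⊎ Fb E W (c * size W)) →
      Good ⊎ ∃ λ β → Fb E W₀ β × 2 * (k * k) * β ≤ 2 * (k * k) * (c * size W₀) + 5 * (size W₀ * size W₀)
    decompose k c {Good} W₀ leaf = go (size W₀) W₀ (λ v p → p) ≤-refl
      where
      go : ∀ fuel W → W ⊑ W₀ → size W ≤ fuel →
        Good ⊎ ∃ λ β → Fb E W β × 2 * (k * k) * β ≤ 2 * (k * k) * (c * size W) + 5 * (size W * size W)
      go fuel W sub le with robust-or-sparse k W
      ... | inj₁ rob = [ inj₁ , (λ fb → inj₂ (_ , fb , m≤m+n _ _)) ]′ (leaf W sub rob)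
      go zero W sub le | inj₂ (S , sparse) = ⊥-elim (n≮0 (<-≤-trans sparse
        (≤-reflexive (cong (λ x → 5 * (x * size (W ∖ S))) (n≤0⇒n≡0 (≤-trans (size-mono λ v p → proj₁ (∧-elim p)) le))))))
      go (suc fuel) W sub le | inj₂ (S , sparse) = combine
          (go fuel A (λ v p → sub v (proj₁ (∧-elim p))) (smaller b≥1 (trans (+-comm b a) a+b)))
          (go fuel B (λ v p → sub v (proj₁ (∧-elim p))) (smaller a≥1 a+b))
        where
        A = W ∩ S
        B = W ∖ S
        a = size A
        b = size B
        a+b : a + b ≡ size W
        a+b = size-split W S
        smaller : ∀ {x y} → 1 ≤ x → x + y ≡ size W → y ≤ fuel
        smaller {x} {y} x≥1 eq = ≤-pred (≤-trans (+-monoˡ-≤ y x≥1) (≤-trans (≤-reflexive eq) le))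
        -- A strictly sparse cut has |A||B| > 0, so both sides are nonempty and the recursion
        -- shrinks.
        a≥1 : 1 ≤ a
        a≥1 = n≢0⇒n>0 λ eq → n≮0 (<-≤-trans sparse (≤-reflexive (cong (λ x → 5 * (x * b)) eq)))
        b≥1 : 1 ≤ b
        b≥1 = n≢0⇒n>0 λ eq → n≮0 (<-≤-trans sparse (≤-reflexive (trans (cong (λ x → 5 * (a * x)) eq) (cong (5 *_) (*-zeroʳ a)))))
        Result : VSet n → Set
        Result X = ∃ λ β → Fb E X β × 2 * (k * k) * β ≤ 2 * (k * k) * (c * size X) + 5 * (size X * size X)
        cover : ∀ v → T (W v) → T (A v) ⊎ T (B v)
        cover v w with T? (S v)
        ... | yes s = inj₁ (∧-intro w s)
        ... | no ¬s = inj₂ (∖-intro W S w ¬s)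
        combine : Good ⊎ Result A → Good ⊎ Result B → Good ⊎ Result W
        combine (inj₁ g) _ = inj₁ g
        combine (inj₂ _) (inj₁ g) = inj₁ g
        combine (inj₂ (β , fA , leA)) (inj₂ (γ , fB , leB)) = inj₂ (β + γ + e , Fb-union {W} cover fA fB , (begin
          2 * (k * k) * (β + γ + e)                                   ≡⟨ id₁ (k * k) β γ e ⟩
          2 * (k * k) * β + 2 * (k * k) * γ + 2 * (k * k * e)         ≤⟨ +-mono-≤ (+-mono-≤ leA leB) (*-monoʳ-≤ 2 (<⇒≤ sparse)) ⟩
          (2 * (k * k) * (c * a) + 5 * (a * a)) + (2 * (k * k) * (c * b) + 5 * (b * b)) + 2 * (5 * (a * b))
                                                                      ≡⟨ id₂ (k * k) c a b ⟩
          2 * (k * k) * (c * (a + b)) + 5 * ((a + b) * (a + b))       ≡⟨ cong (λ x → 2 * (k * k) * (c * x) + 5 * (x * x)) a+b ⟩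
          2 * (k * k) * (c * size W) + 5 * (size W * size W) ∎))
          where
          open ≤-Reasoning
          e = edges E A B
          id₁ : ∀ q β γ e → 2 * q * (β + γ + e) ≡ 2 * q * β + 2 * q * γ + 2 * (q * e)
          id₁ = solve-∀
          id₂ : ∀ q c a b → (2 * q * (c * a) + 5 * (a * a)) + (2 * q * (c * b) + 5 * (b * b)) + 2 * (5 * (a * b)) ≡
                            2 * q * (c * (a + b)) + 5 * ((a + b) * (a + b))
          id₂ = solve-∀

    -- The discarded set Y goes first: it costs at most |Y|² inside and |X||Y| for the edges from X,
    -- together |Y||W|.
    Fb-discard : ∀ {W X} → X ⊑ W → ∀ {a} → Fb E X a → Fb E W (a + size (W ∖ X) * size W)
    Fb-discard {W} {X} sub {a} fX = Fb-weaken {W} bound (Fb-union {W} cover fX (Fb-trivial Y))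
      where
      Y = W ∖ X
      cover : ∀ v → T (W v) → T (X v) ⊎ T (Y v)
      cover v w with T? (X v)
      ... | yes s = inj₁ s
      ... | no ¬s = inj₂ (∖-intro W X w ¬s)
      bound : a + size Y * size Y + edges E X Y ≤ a + size Y * size W
      bound = begin
        a + size Y * size Y + edges E X Y           ≤⟨ +-monoʳ-≤ (a + size Y * size Y) (edges≤*size E X Y) ⟩
        a + size Y * size Y + size Y * size X       ≡⟨ id₁ a (size Y) (size X) ⟩
        a + size Y * (size X + size Y)              ≡⟨ cong (λ x → a + size Y * x) (size-∖ W X sub) ⟩
        a + size Y * size W ∎
        where
        open ≤-Reasoning
        id₁ : ∀ a y x → a + y * y + y * x ≡ a + y * (x + y)
        id₁ = solve-∀

    -- Greedy removal: a vertex of in-degree below s in the remaining set is placed before it, so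
    -- that only its in-edges become backward. The removal stops at the empty set or at a set of
    -- minimum in-degree s.
    peel : ∀ s X → Fb E X (s * size X) ⊎
      ∃ λ Y → Y ⊑ X × (∃ λ y → T (Y y)) × (∀ v → T (Y v) → s ≤ outdeg (flip E) Y v)
    peel s X = go (size X) X (λ v p → p) ≤-refl
      where
      Dense : VSet n → Set
      Dense X = ∃ λ Y → Y ⊑ X × (∃ λ y → T (Y y)) × (∀ v → T (Y v) → s ≤ outdeg (flip E) Y v)
      go : ∀ fuel Y → Y ⊑ X → size Y ≤ fuel → Fb E Y (s * size Y) ⊎ Dense X
      go fuel Y sub le with any? (λ v → T? (Y v) ×-dec outdeg (flip E) Y v <? s)
      go fuel Y sub le | no ¬low with any? (λ v → T? (Y v))
      ... | yes y = inj₂ (Y , sub , y , λ v p → ≮⇒≥ λ lt → ¬low (v , p , lt))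
      ... | no ∅ = inj₁ ((λ _ → 0) , ≤-trans (pairs-mono λ u v p → ⊥-elim (∅ (u , proj₁ (∧-elim p)))) (edges-∅))
        where
        edges-∅ : edges E Y Y ≤ s * size Y
        edges-∅ = ≤-trans (edges≤*size E Y Y) (≤-reflexive (trans (cong (_* size Y) y≡0) (sym (trans (cong (s *_) y≡0) (*-zeroʳ s)))))
          where
          y≡0 = size-∅ λ v p → ∅ (v , p)
      go zero Y sub le | yes (v , p , lt) = ⊥-elim (n≮0 (≤-trans (member⇒size v p) le))
      go (suc fuel) Y sub le | yes (v , p , lt) with go fuel (Y ∖ ⁅ v ⁆) (λ u q → sub u (proj₁ (∧-elim q)))
                                                       (≤-pred (≤-trans (≤-reflexive split) le))
        where
        split : suc (size (Y ∖ ⁅ v ⁆)) ≡ size Y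
        split = trans (cong (_+ size (Y ∖ ⁅ v ⁆)) (sym (size-⁅⁆ v))) (size-∖ Y ⁅ v ⁆ (⁅⁆⊑ {A = Y} p))
      ... | inj₂ dense = inj₂ dense
      ... | inj₁ fb = inj₁ (Fb-weaken {Y} bound (Fb-union {Y} cover fb (Fb-trivial ⁅ v ⁆)))
        where
        Z = Y ∖ ⁅ v ⁆
        cover : ∀ u → T (Y u) → T (Z u) ⊎ T (⁅ v ⁆ u)
        cover u y with T? (⁅ v ⁆ u)
        ... | yes q = inj₂ q
        ... | no ¬q = inj₁ (∖-intro Y ⁅ v ⁆ y ¬q)
        d = outdeg (flip E) Y v
        into : edges E Z ⁅ v ⁆ ≤ d
        into = ≤-trans (edges-≤-indeg E Z ⁅ v ⁆ d λ u q → subst (λ x → outdeg (flip E) Z x ≤ d) (sym (toWitness q))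
                  (size-mono λ w r → let (z , e) = ∧-elim {Z w} r in ∧-intro (proj₁ (∧-elim {Y w} z)) e))
               (≤-reflexive (trans (cong (d *_) (size-⁅⁆ v)) (*-identityʳ d)))
        -- The 1 is the trivial bound for the single vertex; d < s is strict, so 1 + d still fits
        -- into s.
        bound : s * size Z + size ⁅ v ⁆ * size ⁅ v ⁆ + edges E Z ⁅ v ⁆ ≤ s * size Y
        bound = begin
          s * size Z + size ⁅ v ⁆ * size ⁅ v ⁆ + edges E Z ⁅ v ⁆    ≤⟨ +-mono-≤ (≤-reflexive (cong (λ x → s * size Z + x * x) (size-⁅⁆ v))) into ⟩
          s * size Z + 1 + d                                        ≡⟨ +-assoc (s * size Z) 1 d ⟩
          s * size Z + suc d                                        ≤⟨ +-monoʳ-≤ (s * size Z) lt ⟩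
          s * size Z + s                                            ≡⟨ id₁ s (size Z) ⟩
          s * (1 + size Z)                                          ≡⟨ cong (λ x → s * (x + size Z)) (size-⁅⁆ v) ⟨
          s * (size ⁅ v ⁆ + size Z)                                 ≡⟨ cong (s *_) (size-∖ Y ⁅ v ⁆ (⁅⁆⊑ {A = Y} p)) ⟩
          s * size Y ∎
          where
          open ≤-Reasoning
          id₁ : ∀ s z → s * z + s ≡ s * (1 + z)
          id₁ = solve-∀

  -- Growth of robust neighbourhoods

  -- Asking for t in-neighbours lets a path back to u dodge fewer than t forbidden vertices at every step.
  reach : ∀ {n} → Rel n → VSet n → ℕ → Fin n → ℕ → VSet n
  reach E W t u zero    w = W w ∧ E u w
  reach E W t u (suc j) w = W w ∧ (t ≤ᵇ outdeg (flip E) (reach E W t u j) w)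

  reach⊑ : ∀ {n} (E : Rel n) W t u j → reach E W t u j ⊑ W
  reach⊑ E W t u zero    v p = proj₁ (∧-elim p)
  reach⊑ E W t u (suc j) v p = proj₁ (∧-elim p)

  upto : ∀ {n} → (ℕ → VSet n) → ℕ → VSet n
  upto R zero    = λ _ → false
  upto R (suc j) = upto R j ∪ R j

  upto⁻ : ∀ {n} (R : ℕ → VSet n) k {v} → T (upto R k v) → ∃ λ j → j < k × T (R j v)
  upto⁻ R (suc k) {v} p with ∨-elim {upto R k v} p
  ... | inj₂ q = k , ≤-refl , q
  ... | inj₁ q = let (j , lt , r) = upto⁻ R k q in j , m≤n⇒m≤1+n lt , r

  4xy≤[x+y]² : ∀ x y → 4 * (x * y) ≤ (x + y) * (x + y)
  4xy≤[x+y]² x y with ≤-total x y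
  ... | inj₁ x≤y = subst (λ y → 4 * (x * y) ≤ (x + y) * (x + y)) (m+[n∸m]≡n x≤y)
                     (≤-trans (m≤m+n _ ((y ∸ x) * (y ∸ x))) (≤-reflexive (id₁ x (y ∸ x))))
    where
    id₁ : ∀ x d → 4 * (x * (x + d)) + d * d ≡ (x + (x + d)) * (x + (x + d))
    id₁ = solve-∀
  ... | inj₂ y≤x = subst (λ x → 4 * (x * y) ≤ (x + y) * (x + y)) (m+[n∸m]≡n y≤x)
                     (≤-trans (m≤m+n _ ((x ∸ y) * (x ∸ y))) (≤-reflexive (id₁ y (x ∸ y))))
    where
    id₁ : ∀ y d → 4 * ((y + d) * y) + d * d ≡ ((y + d) + y) * ((y + d) + y)
    id₁ = solve-∀

  -- The bound `big` makes the error terms, coming from in-degrees of at most t that `reach`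
  -- ignores, negligible against the main terms; the summand 3 pays for |W| - 1 in place of |W|.
  module Growth {n} (E : Rel n) {k W} (rob : Robust k E W) {t} (k≥1 : 1 ≤ k) (t≥1 : 1 ≤ t)
                (big : 41 * (k * k * k * k * k * t) + 3 ≤ size W) where

    N = size W
    instance
      k≢0 = >-nonZero k≥1
      t≢0 = >-nonZero t≥1

    N≥1 : 1 ≤ N
    N≥1 = ≤-trans (≤-trans (m≤m+n 1 2) (m≤n+m 3 (41 * (k * k * k * k * k * t)))) big

    -- Robustness of the cut that separates u alone.
    outdeg-lower : ∀ u → T (W u) → 5 * (N ∸ 1) ≤ k * k * outdeg E W u
    outdeg-lower u wu = begin
      5 * (N ∸ 1)                                       ≡⟨ cong (λ x → 5 * (x ∸ 1)) split ⟨
      5 * size (W ∖ ⁅ u ⁆)                              ≡⟨ cong (5 *_) (*-identityˡ (size (W ∖ ⁅ u ⁆))) ⟨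
      5 * (1 * size (W ∖ ⁅ u ⁆))                        ≡⟨ cong (λ x → 5 * (x * size (W ∖ ⁅ u ⁆))) (size-⁅⁆ u) ⟨
      5 * (size ⁅ u ⁆ * size (W ∖ ⁅ u ⁆))               ≤⟨ robust-cut E {k} {W} rob (⁅⁆⊑ {A = W} wu) ⟩
      k * k * edges E ⁅ u ⁆ (W ∖ ⁅ u ⁆)                 ≤⟨ *-monoʳ-≤ (k * k) (edges-≤-outdeg E ⁅ u ⁆ (W ∖ ⁅ u ⁆) (outdeg E W u) deg) ⟩
      k * k * (outdeg E W u * size ⁅ u ⁆)               ≡⟨ cong (λ x → k * k * (outdeg E W u * x)) (size-⁅⁆ u) ⟩
      k * k * (outdeg E W u * 1)                        ≡⟨ cong (k * k *_) (*-identityʳ (outdeg E W u)) ⟩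
      k * k * outdeg E W u ∎
      where
      open ≤-Reasoning
      split : suc (size (W ∖ ⁅ u ⁆)) ≡ N
      split = trans (cong (_+ size (W ∖ ⁅ u ⁆)) (sym (size-⁅⁆ u))) (size-∖ W ⁅ u ⁆ (⁅⁆⊑ {A = W} wu))
      deg : ∀ v → T (⁅ u ⁆ v) → outdeg E (W ∖ ⁅ u ⁆) v ≤ outdeg E W u
      deg v p = subst (λ x → outdeg E (W ∖ ⁅ u ⁆) x ≤ outdeg E W u) (sym (toWitness p))
        (size-mono λ x q → let (a , e) = ∧-elim {(W ∖ ⁅ u ⁆) x} q in ∧-intro (proj₁ (∧-elim a)) e)

    6N≤55[N∸1] : 6 * N ≤ 11 * (5 * (N ∸ 1))
    6N≤55[N∸1] = lemma N (≤-trans (m≤n+m 3 _) big)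
      where
      lemma : ∀ N → 3 ≤ N → 6 * N ≤ 11 * (5 * (N ∸ 1))
      lemma (suc M) (s≤s M≥2) = begin
        6 * suc M           ≡⟨ id₁ M ⟩
        6 * M + 3 * 2       ≤⟨ +-monoʳ-≤ (6 * M) (*-monoʳ-≤ 3 M≥2) ⟩
        6 * M + 3 * M       ≤⟨ m≤m+n _ (46 * M) ⟩
        6 * M + 3 * M + 46 * M ≡⟨ id₂ M ⟩
        11 * (5 * M) ∎
        where
        open ≤-Reasoning
        id₁ : ∀ M → 6 * suc M ≡ 6 * M + 3 * 2
        id₁ = solve-∀
        id₂ : ∀ M → 6 * M + 3 * M + 46 * M ≡ 11 * (5 * M)
        id₂ = solve-∀

    -- The vertices of R send at least 5(N - 1)r/k² edges into W, of which at most tN end outside R′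
    -- and at most r r′ inside. If r′ were small, r would be of order k²t, against the induction
    -- hypothesis for large N.
    reach-size : ∀ u → T (W u) → ∀ j → 6 * N ≤ 11 * (k * k * size (reach E W t u j))
    reach-size u wu zero    = ≤-trans 6N≤55[N∸1] (*-monoʳ-≤ 11 (outdeg-lower u wu))
    reach-size u wu (suc j) = ≮⇒≥ λ lt → <⇒≱ (gap (≤-trans (m≤m+n _ 3) big)) (contra lt)
      where
      R  = reach E W t u j
      R′ = reach E W t u (suc j)
      r  = size R
      r′ = size R′
      few : ∀ v → T ((W ∖ R′) v) → outdeg (flip E) R v ≤ t
      few v p = let (w , ¬r) = ∖-elim W R′ p in <⇒≤ (≰⇒> λ le → ¬r (∧-intro w (≤⇒≤ᵇ le)))
      total : edges E R W ≤ r′ * r + t * N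
      total = begin
        edges E R W                                ≤⟨ pairs-cover₃ {A = λ x y → R x ∧ R′ y ∧ E x y} {B = λ x y → R x ∧ (W ∖ R′) y ∧ E x y} {C = λ _ _ → false} classify ⟩
        edges E R R′ + edges E R (W ∖ R′) + pairs (λ _ _ → false) ≤⟨ +-mono-≤ (+-mono-≤ (edges≤*size E R R′) (edges-≤-indeg E R (W ∖ R′) t few)) none ⟩
        r′ * r + t * size (W ∖ R′) + 0             ≡⟨ +-identityʳ _ ⟩
        r′ * r + t * size (W ∖ R′)                 ≤⟨ +-monoʳ-≤ (r′ * r) (*-monoʳ-≤ t (size-mono λ v p → proj₁ (∧-elim p))) ⟩
        r′ * r + t * N ∎
        where
        open ≤-Reasoning
        none : pairs {n} (λ _ _ → false) ≤ 0
        none = ≤-trans (≤-reflexive (sym (*-identityˡ (pairs {n} (λ _ _ → false))))) (*pairs≤*size (λ _ _ → false) (λ _ → false) 1 0 (λ u v ()) (λ u ()))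
        classify : ∀ x y → T (R x ∧ W y ∧ E x y) → T (R x ∧ R′ y ∧ E x y) ⊎ T (R x ∧ (W ∖ R′) y ∧ E x y) ⊎ T false
        classify x y p with ∧-elim {R x} p
        ... | rx , q with ∧-elim {W y} q | T? (R′ y)
        ... | wy , e | yes ry = inj₁ (∧-intro rx (∧-intro ry e))
        ... | wy , e | no ¬ry = inj₂ (inj₁ (∧-intro rx (∧-intro (∖-intro W R′ wy ¬ry) e)))
      lower : 5 * (N ∸ 1) * r ≤ k * k * edges E R W
      lower = edges-≥-outdeg E R W (k * k) (5 * (N ∸ 1)) λ x p → outdeg-lower x (reach⊑ E W t u j x p)
      contra : 11 * (k * k * r′) < 6 * N → 552 * N ≤ 363 * (k * k * k * k * t)
      contra lt = begin
        552 * N                           ≡⟨ *-assoc 92 6 N ⟩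
        92 * (6 * N)                      ≤⟨ *-monoʳ-≤ 92 (reach-size u wu j) ⟩
        92 * (11 * (k * k * r))           ≡⟨ id₁ (k * k) r ⟩
        11 * (k * k) * (92 * r)           ≤⟨ *-monoʳ-≤ (11 * (k * k)) r-small ⟩
        11 * (k * k) * (33 * (k * k * t)) ≡⟨ id₂ k t ⟩
        363 * (k * k * k * k * t) ∎
        where
        open ≤-Reasoning
        id₁ : ∀ q r → 92 * (11 * (q * r)) ≡ 11 * q * (92 * r)
        id₁ = solve-∀
        id₂ : ∀ k t → 11 * (k * k) * (33 * (k * k * t)) ≡ 363 * (k * k * k * k * t)
        id₂ = solve-∀
        key : 11 * (5 * (N ∸ 1)) * r ≤ 6 * N * r + 11 * (k * k * (t * N))
        key = begin
          11 * (5 * (N ∸ 1)) * r                     ≡⟨ *-assoc 11 (5 * (N ∸ 1)) r ⟩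
          11 * (5 * (N ∸ 1) * r)                     ≤⟨ *-monoʳ-≤ 11 (≤-trans lower (*-monoʳ-≤ (k * k) total)) ⟩
          11 * (k * k * (r′ * r + t * N))            ≡⟨ id₃ (k * k) r′ r (t * N) ⟩
          11 * (k * k * r′) * r + 11 * (k * k * (t * N)) ≤⟨ +-monoˡ-≤ _ (*-monoˡ-≤ r (<⇒≤ lt)) ⟩
          6 * N * r + 11 * (k * k * (t * N)) ∎
          where
          id₃ : ∀ q a r b → 11 * (q * (a * r + b)) ≡ 11 * (q * a) * r + 11 * (q * b)
          id₃ = solve-∀
        -- With N = M + 1, three times 55M - 6(M + 1) is at least 92(M + 1) exactly when M ≥ 2.
        r-small : 92 * r ≤ 33 * (k * k * t)
        r-small = lemma N (≤-trans (m≤n+m 3 _) big) key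
          where
          lemma : ∀ N → 3 ≤ N → 11 * (5 * (N ∸ 1)) * r ≤ 6 * N * r + 11 * (k * k * (t * N)) → 92 * r ≤ 33 * (k * k * t)
          lemma (suc M) (s≤s M≥2) h = *-cancelʳ-≤ (92 * r) (33 * (k * k * t)) (suc M) (+-cancelˡ-≤ (27 * M * r) _ _ (begin
            27 * M * r + 92 * r * suc M                       ≡⟨ id₅ M r ⟩
            119 * M * r + 46 * r * 2                          ≤⟨ +-monoʳ-≤ (119 * M * r) (*-monoʳ-≤ (46 * r) M≥2) ⟩
            119 * M * r + 46 * r * M                          ≡⟨ id₄ M r ⟩
            3 * (11 * (5 * M) * r)                            ≤⟨ *-monoʳ-≤ 3 h ⟩
            3 * (6 * suc M * r + 11 * (k * k * (t * suc M)))  ≡⟨ id₆ M r (k * k) t ⟩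
            18 * M * r + 9 * r * 2 + 33 * (k * k * t) * suc M ≤⟨ +-monoˡ-≤ _ (+-monoʳ-≤ (18 * M * r) (*-monoʳ-≤ (9 * r) M≥2)) ⟩
            18 * M * r + 9 * r * M + 33 * (k * k * t) * suc M ≡⟨ cong (_+ 33 * (k * k * t) * suc M) (id₇ M r) ⟩
            27 * M * r + 33 * (k * k * t) * suc M ∎))
            where
            id₄ : ∀ M r → 119 * M * r + 46 * r * M ≡ 3 * (11 * (5 * M) * r)
            id₄ = solve-∀
            id₅ : ∀ M r → 27 * M * r + 92 * r * suc M ≡ 119 * M * r + 46 * r * 2
            id₅ = solve-∀
            id₆ : ∀ M r q t → 3 * (6 * suc M * r + 11 * (q * (t * suc M))) ≡ 18 * M * r + 9 * r * 2 + 33 * (q * t) * suc M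
            id₆ = solve-∀
            id₇ : ∀ M r → 18 * M * r + 9 * r * M ≡ 27 * M * r
            id₇ = solve-∀
      gap : 41 * (k * k * k * k * k * t) ≤ N → 363 * (k * k * k * k * t) < 552 * N
      gap le = begin-strict
        363 * x                        ≤⟨ *-monoʳ-≤ 363 (m≤m*n x k) ⟩
        363 * (x * k)                  ≡⟨ cong (363 *_) (id₁ k t) ⟩
        363 * y                        <⟨ *-monoˡ-< y (m<m+n 363 {22269} (s≤s z≤n)) ⟩
        (363 + 22269) * y              ≡⟨ *-assoc 552 41 y ⟩
        552 * (41 * y)                 ≤⟨ *-monoʳ-≤ 552 le ⟩
        552 * N ∎
        where
        open ≤-Reasoning
        x = k * k * k * k * t
        y = k * k * k * k * k * t
        instance
          y≢0 : NonZero y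
          y≢0 = m*n≢0 (k * k * k * k * k) t {{m*n≢0 (k * k * k * k) k {{m*n≢0 (k * k * k) k {{m*n≢0 (k * k) k {{m*n≢0 k k}}}}}}}}
        id₁ : ∀ k t → k * k * k * k * t * k ≡ k * k * k * k * k * t
        id₁ = solve-∀

    -- With b_j = |upto R j| and layers l_j = b_{j+1} - b_j, robustness gives 5 b_{j+1}(N - b_{j+1}) ≤ k² l_j l_{j+1} up to O(N),
    -- and 4 l_j l_{j+1} ≤ (b_{j+2} - b_j)²; since (j+2)² - j² = 4(j+1), quadratic growth propagates.
    module _ (R : ℕ → VSet n) (R⊑ : ∀ j → R j ⊑ W)
             (few : ∀ j w → T (W w) → ¬ T (R (suc j) w) → outdeg (flip E) (R j) w ≤ t)
             (R₀ : 6 * N ≤ 11 * (k * k * size (R 0))) where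

      upto⊑ : ∀ j → upto R j ⊑ W
      upto⊑ (suc j) v p = [ upto⊑ j v , R⊑ j v ]′ (∨-elim {upto R j v} p)

      -- A vertex missing from layer `R (suc i)` has at most t in-neighbours in layer `R i`; this is
      -- summed over i < j.
      few-upto : ∀ j w → T (W w) → ¬ T (upto R (suc j) w) → outdeg (flip E) (upto R j) w ≤ j * t
      few-upto zero w p ∉ = ≤-reflexive (size-∅ λ v ())
      few-upto (suc j) w p ∉ = begin
        outdeg (flip E) (upto R (suc j)) w                        ≤⟨ size-cover (λ v q → split v (∧-elim {upto R (suc j) v} q)) ⟩
        outdeg (flip E) (R j) w + outdeg (flip E) (upto R j) w    ≤⟨ +-mono-≤ (few j w p (∉ ∘ ∨-introʳ {upto R (suc j) w}))
                                                                              (few-upto j w p (∉ ∘ ∨-introˡ)) ⟩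
        t + j * t ∎
        where
        open ≤-Reasoning
        split : ∀ v → T (upto R (suc j) v) × T (E v w) → T (R j v ∧ E v w) ⊎ T (upto R j v ∧ E v w)
        split v (q , e) with ∨-elim {upto R j v} q
        ... | inj₁ old = inj₂ (∧-intro old e)
        ... | inj₂ new = inj₁ (∧-intro new e)

      -- An edge leaving C₁ either runs between the consecutive layers C₁ ∖ C and C₂ ∖ C₁, or skips
      -- one by starting in C or ending outside C₂. By `few-upto` the skipping edges number only
      -- O(N).
      boundary : ∀ j → let C = upto R j ; C₁ = upto R (suc j) ; C₂ = upto R (suc (suc j)) in
        edges E C₁ (W ∖ C₁) ≤ size (C₂ ∖ C₁) * size (C₁ ∖ C) + (j * t * N + suc j * t * N)
      boundary j = begin
        edges E C₁ (W ∖ C₁)      ≤⟨ pairs-cover₃ classify ⟩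
        edges E (C₁ ∖ C) (C₂ ∖ C₁) + edges E C (W ∖ C₁) + edges E C₁ (W ∖ C₂) ≤⟨ +-mono-≤ (+-mono-≤ (edges≤*size E (C₁ ∖ C) (C₂ ∖ C₁)) (thin j)) (thin (suc j)) ⟩
        size (C₂ ∖ C₁) * size (C₁ ∖ C) + j * t * N + suc j * t * N ≡⟨ +-assoc (size (C₂ ∖ C₁) * size (C₁ ∖ C)) _ _ ⟩
        size (C₂ ∖ C₁) * size (C₁ ∖ C) + (j * t * N + suc j * t * N) ∎
        where
        open ≤-Reasoning
        C  = upto R j
        C₁ = upto R (suc j)
        C₂ = upto R (suc (suc j))
        thin : ∀ j → edges E (upto R j) (W ∖ upto R (suc j)) ≤ j * t * N
        thin j = ≤-trans (edges-≤-indeg E (upto R j) (W ∖ upto R (suc j)) (j * t)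
                           λ v p → let (w , ∉) = ∖-elim W (upto R (suc j)) p in few-upto j v w ∉)
                         (*-monoʳ-≤ (j * t) (size-mono λ v p → proj₁ (∧-elim p)))
        classify : ∀ x y → T (C₁ x ∧ (W ∖ C₁) y ∧ E x y) →
          T ((C₁ ∖ C) x ∧ (C₂ ∖ C₁) y ∧ E x y) ⊎ T (C x ∧ (W ∖ C₁) y ∧ E x y) ⊎ T (C₁ x ∧ (W ∖ C₂) y ∧ E x y)
        classify x y p with ∧-elim {C₁ x} p
        ... | cx , q with ∧-elim {(W ∖ C₁) y} q
        ... | wy , e with T? (C x) | T? (C₂ y)
        ... | yes x∈ | _ = inj₂ (inj₁ (∧-intro x∈ (∧-intro wy e)))
        ... | no x∉ | yes y∈ = inj₁ (∧-intro (∖-intro C₁ C cx x∉) (∧-intro (∖-intro C₂ C₁ y∈ (proj₂ (∖-elim W C₁ wy))) e))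
        ... | no x∉ | no y∉ = inj₂ (inj₂ (∧-intro cx (∧-intro (∖-intro W C₂ (proj₁ (∖-elim W C₁ wy)) y∉) e)))

      growth-step : ∀ j → 2 + j ≤ k → 6 * (j * j * N) ≤ 11 * (k * k * size (upto R j)) →
        6 * (suc j * suc j * N) ≤ 11 * (k * k * size (upto R (suc j))) →
        6 * ((2 + j) * (2 + j) * N) ≤ 11 * (k * k * size (upto R (2 + j)))
      growth-step j 2+j≤k ih₀ ih₁ with 6 * N ≤? 11 * size (upto R (suc (suc j)))
      -- Once the union holds 6/11 of W, the claim follows from 2 + j ≤ k alone.
      ... | yes full = begin
            6 * ((2 + j) * (2 + j) * N)   ≤⟨ *-monoʳ-≤ 6 (*-monoˡ-≤ N (*-mono-≤ 2+j≤k 2+j≤k)) ⟩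
            6 * (k * k * N)               ≡⟨ id₁ (k * k) 6 N ⟩
            k * k * (6 * N)               ≤⟨ *-monoʳ-≤ (k * k) full ⟩
            k * k * (11 * size (upto R (2 + j))) ≡⟨ id₁ (k * k) 11 (size (upto R (2 + j))) ⟨
            11 * (k * k * size (upto R (2 + j))) ∎
        where
        open ≤-Reasoning
        id₁ : ∀ q c N → c * (q * N) ≡ q * (c * N)
        id₁ = solve-∀
      ... | no ¬full = ≮⇒≥ λ lt → <⇒≱ gap (contra lt)
        where
        open ≤-Reasoning
        C₀ = upto R j
        C₁ = upto R (suc j)
        C₂ = upto R (suc (suc j))
        b₀ = size C₀
        b₁ = size C₁
        b₂ = size C₂
        l  = size (C₁ ∖ C₀)
        l′ = size (C₂ ∖ C₁)
        y  = size (W ∖ C₁)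
        s  = j * t * N + suc j * t * N
        b₁≡ : b₀ + l ≡ b₁
        b₁≡ = size-∖ C₁ C₀ λ v → ∨-introˡ
        b₂≡ : b₁ + l′ ≡ b₂
        b₂≡ = size-∖ C₂ C₁ λ v → ∨-introˡ
        rest : 5 * N ≤ 11 * y
        rest = +-cancelˡ-≤ (6 * N) _ _ (begin
          6 * N + 5 * N      ≡⟨ *-distribʳ-+ N 6 5 ⟨
          11 * N             ≡⟨ cong (11 *_) (size-∖ W C₁ (upto⊑ (suc j))) ⟨
          11 * (b₁ + y)      ≡⟨ *-distribˡ-+ 11 b₁ y ⟩
          11 * b₁ + 11 * y   ≤⟨ +-monoˡ-≤ (11 * y) (≤-trans (*-monoʳ-≤ 11 (≤-trans (m≤m+n b₁ l′) (≤-reflexive b₂≡))) (<⇒≤ (≰⇒> ¬full))) ⟩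
          6 * N + 11 * y ∎)
        layers : 11 * (k * k * b₂) < 6 * ((2 + j) * (2 + j) * N) → 11 * (k * k) * (l′ + l) ≤ 24 * (suc j * N)
        layers lt = +-cancelˡ-≤ (6 * (j * j * N)) _ _ (begin
          6 * (j * j * N) + 11 * (k * k) * (l′ + l)         ≤⟨ +-monoˡ-≤ _ ih₀ ⟩
          11 * (k * k * b₀) + 11 * (k * k) * (l′ + l)       ≡⟨ id₁ (k * k) b₀ l l′ ⟩
          11 * (k * k * (b₀ + l + l′))                      ≡⟨ cong (λ x → 11 * (k * k * x)) (trans (cong (_+ l′) b₁≡) b₂≡) ⟩
          11 * (k * k * b₂)                                 ≤⟨ <⇒≤ lt ⟩
          6 * ((2 + j) * (2 + j) * N)                       ≡⟨ id₂ j N ⟩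
          6 * (j * j * N) + 24 * (suc j * N) ∎)
          where
          id₁ : ∀ q b l m → 11 * (q * b) + 11 * q * (m + l) ≡ 11 * (q * (b + l + m))
          id₁ = solve-∀
          id₂ : ∀ j N → 6 * ((2 + j) * (2 + j) * N) ≡ 6 * (j * j * N) + 24 * (suc j * N)
          id₂ = solve-∀
        A = suc j * N
        -- The cut forces 4 · 5 · 6 · 5 = 600 copies of A², while the two layers supply at most 24²
        -- = 576 and an O(N) error. The fractions 6/11 reached and 5/11 left are compatible because
        -- 5 · 5 > 4 · 6.
        contra : 11 * (k * k * b₂) < 6 * ((2 + j) * (2 + j) * N) → 24 * (A * A) ≤ 968 * (k * k * k * k * k * t * N)
        contra lt = +-cancelˡ-≤ (576 * (A * A)) _ _ (begin
          576 * (A * A) + 24 * (A * A)                             ≡⟨ *-distribʳ-+ (A * A) 576 24 ⟨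
          600 * (A * A)                                            ≡⟨ id₁ (suc j) N ⟩
          4 * (5 * (6 * (suc j * suc j * N) * (5 * N)))            ≤⟨ *-monoʳ-≤ 4 (*-monoʳ-≤ 5 (*-mono-≤ ih₁ rest)) ⟩
          4 * (5 * (11 * (k * k * b₁) * (11 * y)))                 ≡⟨ id₂ (k * k) b₁ y ⟩
          484 * (k * k) * (5 * (b₁ * y))                           ≤⟨ *-monoʳ-≤ (484 * (k * k)) (robust-cut E {k} {W} rob (upto⊑ (suc j))) ⟩
          484 * (k * k) * (k * k * edges E C₁ (W ∖ C₁))            ≤⟨ *-monoʳ-≤ (484 * (k * k)) (*-monoʳ-≤ (k * k) (boundary j)) ⟩
          484 * (k * k) * (k * k * (l′ * l + s))                   ≡⟨ id₃ (k * k) l′ l s ⟩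
          4 * (11 * (k * k) * l′ * (11 * (k * k) * l)) + 484 * (k * k) * (k * k * s) ≤⟨ +-mono-≤ product small ⟩
          576 * (A * A) + 968 * (k * k * k * k * k * t * N) ∎)
          where
          id₁ : ∀ j N → 600 * (j * N * (j * N)) ≡ 4 * (5 * (6 * (j * j * N) * (5 * N)))
          id₁ = solve-∀
          id₂ : ∀ q b y → 4 * (5 * (11 * (q * b) * (11 * y))) ≡ 484 * q * (5 * (b * y))
          id₂ = solve-∀
          id₃ : ∀ q m l s → 484 * q * (q * (m * l + s)) ≡ 4 * (11 * q * m * (11 * q * l)) + 484 * q * (q * s)
          id₃ = solve-∀
          product : 4 * (11 * (k * k) * l′ * (11 * (k * k) * l)) ≤ 576 * (A * A)
          product = begin
            4 * (11 * (k * k) * l′ * (11 * (k * k) * l))   ≤⟨ 4xy≤[x+y]² (11 * (k * k) * l′) (11 * (k * k) * l) ⟩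
            (11 * (k * k) * l′ + 11 * (k * k) * l) * (11 * (k * k) * l′ + 11 * (k * k) * l) ≡⟨ cong (λ x → x * x) (*-distribˡ-+ (11 * (k * k)) l′ l) ⟨
            11 * (k * k) * (l′ + l) * (11 * (k * k) * (l′ + l)) ≤⟨ *-mono-≤ (layers lt) (layers lt) ⟩
            24 * A * (24 * A)                              ≡⟨ id₄ A ⟩
            576 * (A * A) ∎
            where
            id₄ : ∀ A → 24 * A * (24 * A) ≡ 576 * (A * A)
            id₄ = solve-∀
          small : 484 * (k * k) * (k * k * s) ≤ 968 * (k * k * k * k * k * t * N)
          small = begin
            484 * (k * k) * (k * k * s)               ≤⟨ *-monoʳ-≤ (484 * (k * k)) (*-monoʳ-≤ (k * k) (+-mono-≤ (le (≤-trans (m≤n+m j 2) 2+j≤k)) (le (<⇒≤ 2+j≤k)))) ⟩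
            484 * (k * k) * (k * k * (k * t * N + k * t * N)) ≡⟨ id₄ k t N ⟩
            968 * (k * k * k * k * k * t * N) ∎
            where
            le : ∀ {i} → i ≤ k → i * t * N ≤ k * t * N
            le i≤k = *-monoˡ-≤ N (*-monoˡ-≤ t i≤k)
            id₄ : ∀ k t N → 484 * (k * k) * (k * k * (k * t * N + k * t * N)) ≡ 968 * (k * k * k * k * k * t * N)
            id₄ = solve-∀
        -- The coefficient 41 in `big` comes from here: 24 · 41 = 984 > 968.
        gap : 968 * (k * k * k * k * k * t * N) < 24 * (A * A)
        gap = begin-strict
          968 * (Y * N)                     <⟨ *-monoˡ-< (Y * N) (m<m+n 968 {16} (s≤s z≤n)) ⟩
          984 * (Y * N)                     ≡⟨ id₁ Y N ⟩
          24 * (41 * Y * N)                 ≤⟨ *-monoʳ-≤ 24 (*-monoˡ-≤ N (≤-trans (m≤m+n _ 3) big)) ⟩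
          24 * (N * N)                      ≤⟨ *-monoʳ-≤ 24 (*-mono-≤ (m≤m+n N (j * N)) (m≤m+n N (j * N))) ⟩
          24 * (A * A) ∎
          where
          Y = k * k * k * k * k * t
          instance
            N≢0 = >-nonZero N≥1
            YN≢0 : NonZero (Y * N)
            YN≢0 = m*n≢0 Y N {{m*n≢0 (k * k * k * k * k) t {{m*n≢0 (k * k * k * k) k {{m*n≢0 (k * k * k) k {{m*n≢0 (k * k) k {{m*n≢0 k k}}}}}}}}}}
          id₁ : ∀ Y N → 984 * (Y * N) ≡ 24 * (41 * Y * N)
          id₁ = solve-∀

      growth : ∀ j → j ≤ k → 6 * (j * j * N) ≤ 11 * (k * k * size (upto R j))
      growth zero _ = z≤n
      growth (suc zero) _ = ≤-trans (≤-reflexive (cong (6 *_) (*-identityˡ N))) (≤-trans R₀ (*-monoʳ-≤ 11 (*-monoʳ-≤ (k * k) (size-mono λ v p → p))))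
      growth (suc (suc j)) 2+j≤k = growth-step j 2+j≤k (growth j (≤-trans (m≤n+m j 2) 2+j≤k)) (growth (suc j) (<⇒≤ 2+j≤k))

      -- The case j = k of `growth`. As 6/11 exceeds one half, two such sets must intersect.
      majority : 6 * N ≤ 11 * size (upto R k)
      majority = *-cancelˡ-≤ (k * k) {{m*n≢0 k k}} (begin
        k * k * (6 * N)                  ≡⟨ id₁ (k * k) 6 N ⟩
        6 * (k * k * N)                  ≤⟨ growth k ≤-refl ⟩
        11 * (k * k * size (upto R k))   ≡⟨ id₁ (k * k) 11 (size (upto R k)) ⟨
        k * k * (11 * size (upto R k)) ∎)
        where
        open ≤-Reasoning
        id₁ : ∀ q c N → q * (c * N) ≡ c * (q * N)
        id₁ = solve-∀

  -- Simple paths of prescribed length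

  -- The list holds interior vertices only, so that a closed walk repeats no vertex and joining two
  -- walks turns the common end into an interior vertex.
  data Walk {n} (E : Rel n) : Fin n → List (Fin n) → Fin n → Set where
    edge : ∀ {u v} → T (E u v) → Walk E u [] v
    _∷_  : ∀ {u x xs v} → T (E u x) → Walk E x xs v → Walk E u (x ∷ xs) v

  join : ∀ {n} {E : Rel n} {u xs w ys v} → Walk E u xs w → Walk E w ys v → Walk E u (xs ++ w ∷ ys) v
  join (edge e) q = e ∷ q
  join (e ∷ p)  q = e ∷ join p q

  -- For u ≡ v this is a cycle (of length L + 1) if u ∈ S.
  Conn : ∀ {n} → Rel n → VSet n → List (Fin n) → Fin n → Fin n → ℕ → Set
  Conn E W S u v L = ∃ λ zs → Walk E u zs v × Unique zs × (∀ {x} → x ∈ zs → T (W x) × x ∉ S) × length zs ≡ L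

  ∉⇒All≢ : ∀ {A : Set} {x : A} {xs} → x ∉ xs → All (x ≢_) xs
  ∉⇒All≢ x∉ = All-tabulate λ { y∈ refl → x∉ y∈ }

  module _ {n} (E : Rel n) (W : VSet n) (t : ℕ) where

    -- Each step offers at least t out-neighbours one layer nearer to v, while F, which collects
    -- forbidden and visited vertices, stays shorter than t.
    forward : ∀ {v} j {w} → T (reach (flip E) W t v j w) → ∀ F → length F + j ≤ t → Conn E W F w v j
    forward zero    r F le = [] , edge (proj₂ (∧-elim r)) , [] , (λ ()) , refl
    forward {v} (suc j) {w} r F le with pick {A = λ y → reach (flip E) W t v j y ∧ E w y} F
        (≤-trans (≤-trans (s≤s (m≤m+n _ j)) (≤-trans (≤-reflexive (sym (+-suc _ j))) le)) (≤ᵇ⇒≤ t _ (proj₂ (∧-elim {W w} r))))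
    ... | y , p , y∉F with ∧-elim {reach (flip E) W t v j y} p
    ... | yr , e with forward j yr (y ∷ F) (≤-trans (≤-reflexive (sym (+-suc _ j))) le)
    ... | ys , walk , uniq , avoid , len = y ∷ ys , e ∷ walk , ∉⇒All≢ (λ y∈ → proj₂ (avoid y∈) (here refl)) ∷ uniq , avoid′ , cong suc len
      where
      avoid′ : ∀ {x} → x ∈ y ∷ ys → T (W x) × x ∉ F
      avoid′ (here refl) = reach⊑ (flip E) W t v j y yr , y∉F
      avoid′ (there x∈)  = let (a , b) = avoid x∈ in a , b ∘ there

    -- The walk is extended at its start, one layer nearer to u at a time; in layer 0 its first
    -- vertex is an out-neighbour of u. The final interior consists of `acc`, w and the j added
    -- vertices.
    backward : ∀ {u v} j {w} → T (reach E W t u j w) → ∀ S acc → Walk E w acc v → Unique (w ∷ acc) →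
      (∀ {x} → x ∈ w ∷ acc → T (W x) × x ∉ S) → length S + suc (length acc) + j ≤ t → Conn E W S u v (suc (j + length acc))
    backward zero    {w} r S acc walk uniq avoid le = w ∷ acc , proj₂ (∧-elim {W w} r) ∷ walk , uniq , avoid , refl
    backward {u} (suc j) {w} r S acc walk uniq avoid le with pick {A = λ x → reach E W t u j x ∧ E x w} (S ++ w ∷ acc)
        (≤-trans (s≤s (≤-trans (≤-reflexive (length-++ S)) (m≤m+n _ j))) (≤-trans (≤-reflexive (sym (+-suc _ j))) (≤-trans le (≤ᵇ⇒≤ t _ (proj₂ (∧-elim {W w} r))))))
    ... | x , p , x∉ with ∧-elim {reach E W t u j x} p
    ... | xr , e with backward j xr S (w ∷ acc) (e ∷ walk) (∉⇒All≢ (x∉ ∘ ∈-++⁺ʳ S) ∷ uniq) avoid′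
                       (≤-trans (≤-reflexive (reorder (length S) (length acc) j)) le)
      where
      avoid′ : ∀ {y} → y ∈ x ∷ w ∷ acc → T (W y) × y ∉ S
      avoid′ (here refl) = reach⊑ E W t u j x xr , x∉ ∘ ∈-++⁺ˡ
      avoid′ (there y∈)  = avoid y∈
      reorder : ∀ s a j → s + suc (suc a) + j ≡ s + suc a + suc j
      reorder = solve-∀
    ... | zs , walk′ , uniq′ , av , len = zs , walk′ , uniq′ , av , trans len (cong suc (+-suc j (length acc)))

  reach-few : ∀ {n} (E : Rel n) W t u j w → T (W w) → ¬ T (reach E W t u (suc j) w) → outdeg (flip E) (reach E W t u j) w ≤ t
  reach-few E W t u j w p ¬r = <⇒≤ (≰⇒> λ le → ¬r (∧-intro p (≤⇒≤ᵇ le)))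

  -- The forward and backward unions each fill 6/11 of W, so they share at least N/11 vertices, more
  -- than S can forbid. Through a common vertex of layers j + i and j′ the excess is d = j + j′.
  connect : ∀ {n} (E : Rel n) {k W} → Robust k E W → ∀ {t} → 1 ≤ k → 1 ≤ t → 41 * (k * k * k * k * k * t) + 3 ≤ size W →
    ∀ {u v} → T (W u) → T (W v) → ∀ i S → length S + (i + 2 * k) ≤ t →
    ∃ λ d → d + 2 ≤ 2 * k × Conn E W S u v (suc (i + d))
  connect E {k} {W} rob {t} k≥1 t≥1 big {u} {v} wu wv i S le = meet (pick {A = Out ∩ In} S meeting)
    where
    open ≤-Reasoning
    module O = Growth E {k} {W} rob {t} k≥1 t≥1 big
    module I = Growth (flip E) {k} {W} (robust-flip E {k} {W} rob) {t} k≥1 t≥1 big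
    N = size W
    -- The layers may start at index i because `reach-size` gives each single layer the initial size
    -- that `growth` asks for.
    Ro = λ j → reach E W t u (j + i)
    Ri = reach (flip E) W t v
    Out = upto Ro k
    In  = upto Ri k
    Ro⊑ : ∀ j → Ro j ⊑ W
    Ro⊑ j = reach⊑ E W t u (j + i)
    Ri⊑ : ∀ j → Ri j ⊑ W
    Ri⊑ = reach⊑ (flip E) W t v
    Ro-few : ∀ j w → T (W w) → ¬ T (Ro (suc j) w) → outdeg (flip E) (Ro j) w ≤ t
    Ro-few j = reach-few E W t u (j + i)
    Ri-few : ∀ j w → T (W w) → ¬ T (Ri (suc j) w) → outdeg E (Ri j) w ≤ t
    Ri-few = reach-few (flip E) W t v
    Out-large : 6 * N ≤ 11 * size Out
    Out-large = O.majority Ro Ro⊑ Ro-few (O.reach-size u wu i)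
    In-large : 6 * N ≤ 11 * size In
    In-large = I.majority Ri Ri⊑ Ri-few (I.reach-size v wv 0)
    common : N ≤ 11 * size (Out ∩ In)
    common = +-cancelˡ-≤ (11 * N) _ _ (begin
      11 * N + N                            ≡⟨ id₁ N ⟩
      6 * N + 6 * N                         ≤⟨ +-mono-≤ Out-large In-large ⟩
      11 * size Out + 11 * size In          ≡⟨ *-distribˡ-+ 11 (size Out) (size In) ⟨
      11 * (size Out + size In)             ≤⟨ *-monoʳ-≤ 11 (size-inclusion-exclusion (O.upto⊑ Ro Ro⊑ Ro-few (O.reach-size u wu i) k) (I.upto⊑ Ri Ri⊑ Ri-few (I.reach-size v wv 0) k)) ⟩
      11 * (N + size (Out ∩ In))            ≡⟨ *-distribˡ-+ 11 N _ ⟩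
      11 * N + 11 * size (Out ∩ In) ∎)
      where
      id₁ : ∀ N → 11 * N + N ≡ 6 * N + 6 * N
      id₁ = solve-∀
    meeting : length S < size (Out ∩ In)
    meeting = *-cancelˡ-< 11 _ _ (begin-strict
      11 * length S                          ≤⟨ *-monoʳ-≤ 11 (≤-trans (m≤m+n (length S) (i + 2 * k)) le) ⟩
      11 * t                                 <⟨ *-monoˡ-< t {{>-nonZero t≥1}} (m<m+n 11 {30} (s≤s z≤n)) ⟩
      41 * t                                 ≤⟨ *-monoʳ-≤ 41 (m≤n*m t (k * k * k * k * k) {{k⁵≢0}}) ⟩
      41 * (k * k * k * k * k * t)           ≤⟨ ≤-trans (m≤m+n _ 3) big ⟩
      N                                      ≤⟨ common ⟩
      11 * size (Out ∩ In) ∎)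
      where
      instance
        k≢0 = >-nonZero k≥1
      k⁵≢0 : NonZero (k * k * k * k * k)
      k⁵≢0 = m*n≢0 (k * k * k * k) k {{m*n≢0 (k * k * k) k {{m*n≢0 (k * k) k {{m*n≢0 k k}}}}}}
    meet : (∃ λ w → T ((Out ∩ In) w) × w ∉ S) → ∃ λ d → d + 2 ≤ 2 * k × Conn E W S u v (suc (i + d))
    meet (w , p , w∉S) with ∧-elim {Out w} p
    ... | po , pi with upto⁻ Ro k po | upto⁻ Ri k pi
    ... | j , j<k , rj | j′ , j′<k , rj′ with forward E W t j′ rj′ (w ∷ S) (fits j′<k)
      where
      fits : j′ < k → suc (length S) + j′ ≤ t
      fits lt = begin
        suc (length S) + j′      ≡⟨ +-suc (length S) j′ ⟨
        length S + suc j′        ≤⟨ +-monoʳ-≤ (length S) (≤-trans lt (≤-trans (m≤m+n k (k + 0)) (m≤n+m (2 * k) i))) ⟩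
        length S + (i + 2 * k)   ≤⟨ le ⟩
        t ∎
    ... | ys , walk , uniq , avoid , len with backward E W t (j + i) rj S ys walk (∉⇒All≢ (λ w∈ → proj₂ (avoid w∈) (here refl)) ∷ uniq) avoid′ fits
      where
      avoid′ : ∀ {x} → x ∈ w ∷ ys → T (W x) × x ∉ S
      avoid′ (here refl) = Ro⊑ j w rj , w∉S
      avoid′ (there x∈)  = let (a , b) = avoid x∈ in a , b ∘ there
      fits : length S + suc (length ys) + (j + i) ≤ t
      fits = begin
        length S + suc (length ys) + (j + i)   ≡⟨ cong (λ x → length S + suc x + (j + i)) len ⟩
        length S + suc j′ + (j + i)            ≡⟨ id₁ (length S) j′ j i ⟩
        length S + (i + (j + suc j′))          ≤⟨ +-monoʳ-≤ (length S) (+-monoʳ-≤ i (+-mono-≤ (<⇒≤ j<k) (≤-trans j′<k (≤-reflexive (sym (+-identityʳ k)))))) ⟩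
        length S + (i + 2 * k)                 ≤⟨ le ⟩
        t ∎
        where
        id₁ : ∀ s j′ j i → s + suc j′ + (j + i) ≡ s + (i + (j + suc j′))
        id₁ = solve-∀
    ... | zs , walk′ , uniq′ , av , len′ = j + j′ , bound , zs , walk′ , uniq′ , av ,
        trans len′ (trans (cong (λ x → suc (j + i + x)) len) (id₁ j i j′))
      where
      id₁ : ∀ j i j′ → suc (j + i + j′) ≡ suc (i + (j + j′))
      id₁ j i j′ = cong suc (trans (cong (_+ j′) (+-comm j i)) (+-assoc i j j′))
      bound : j + j′ + 2 ≤ 2 * k
      bound = begin
        j + j′ + 2           ≡⟨ id₂ j j′ ⟩
        suc j + (suc j′ + 0) ≤⟨ +-mono-≤ j<k (+-monoˡ-≤ 0 j′<k) ⟩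
        k + (k + 0) ∎
        where
        id₂ : ∀ j j′ → j + j′ + 2 ≡ suc j + (suc j′ + 0)
        id₂ j j′ = trans (+-assoc j j′ 2) (trans (cong (j +_) (+-comm j′ 2)) (trans (+-suc j (suc j′)) (cong (λ x → suc (j + x)) (sym (+-identityʳ (suc j′))))))

  -- Connectors

  dominated : ∀ {n} → Rel n → List (Fin n) → VSet n
  dominated E []       w = false
  dominated E (r ∷ rs) w = E r w ∨ dominated E rs w

  dominated⁻ : ∀ {n} (E : Rel n) rs {w} → T (dominated E rs w) → ∃ λ r → r ∈ rs × T (E r w)
  dominated⁻ E (r ∷ rs) {w} p with ∨-elim {E r w} p
  ... | inj₁ e = r , here refl , e
  ... | inj₂ q = let (r′ , r′∈ , e) = dominated⁻ E rs q in r′ , there r′∈ , e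

  -- Every vertex has at least N/k² in-neighbours in W outside S. While more than N/k vertices are
  -- uncovered, averaging yields a vertex outside S covering at least N/k³ of them, so k³ greedy
  -- rounds suffice.
  almost-dominating : ∀ {n} (E : Rel n) {k W} → Robust k E W → ∀ {t} → 1 ≤ k → 1 ≤ t → 41 * (k * k * k * k * k * t) + 3 ≤ size W →
    ∀ S → 5 + k * k * length S ≤ 4 * size W →
    ∃ λ R → length R ≤ k * k * k × (∀ {r} → r ∈ R → T (W r) × r ∉ S) × k * size (W ∖ dominated E R) ≤ size W
  almost-dominating {n} E {k} {W} rob {t} k≥1 t≥1 big S S-small = finish (greedy (k * k * k))
    where
    open ≤-Reasoning
    module G = Growth (flip E) {k} {W} (robust-flip E {k} {W} rob) {t} k≥1 t≥1 big
    instance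
      k≢0 = >-nonZero k≥1
    N = size W
    W′ = W ∖ listed S
    rest : List (Fin n) → VSet n
    rest R = W ∖ dominated E R
    State : ℕ → Set
    State τ = ∃ λ R → length R ≤ τ × (∀ {r} → r ∈ R → T (W r) × r ∉ S) ×
      (k * size (rest R) ≤ N ⊎ k * k * k * size (rest R) + τ * N ≤ k * k * k * N)
    indegree : ∀ z → T (W z) → N ≤ k * k * outdeg (flip E) W′ z
    indegree z wz = +-cancelʳ-≤ (4 * N) _ _ (begin
      N + 4 * N                                ≡⟨ five N G.N≥1 ⟩
      5 * (N ∸ 1) + 5                          ≤⟨ +-monoˡ-≤ 5 (G.outdeg-lower z wz) ⟩
      k * k * outdeg (flip E) W z + 5          ≤⟨ +-monoˡ-≤ 5 (*-monoʳ-≤ (k * k) (≤-trans (size-cover {A = λ v → W′ v ∧ E v z} {listed S} split)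
                                                    (+-monoʳ-≤ (outdeg (flip E) W′ z) (size-listed S)))) ⟩
      k * k * (outdeg (flip E) W′ z + length S) + 5 ≡⟨ id₁ (k * k) (outdeg (flip E) W′ z) (length S) ⟩
      k * k * outdeg (flip E) W′ z + (5 + k * k * length S) ≤⟨ +-monoʳ-≤ (k * k * outdeg (flip E) W′ z) S-small ⟩
      k * k * outdeg (flip E) W′ z + 4 * N ∎)
      where
      five : ∀ N → 1 ≤ N → N + 4 * N ≡ 5 * (N ∸ 1) + 5
      five (suc M) _ = lemma M
        where
        lemma : ∀ M → suc M + 4 * suc M ≡ 5 * M + 5
        lemma = solve-∀
      id₁ : ∀ q d s → q * (d + s) + 5 ≡ q * d + (5 + q * s)
      id₁ = solve-∀
      split : ∀ v → T (W v ∧ E v z) → T (W′ v ∧ E v z) ⊎ T (listed S v)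
      split v p with T? (listed S v)
      ... | yes l = inj₂ l
      ... | no ¬l = let (w , e) = ∧-elim {W v} p in inj₁ (∧-intro (∖-intro W (listed S) w ¬l) e)
    rich : ∀ R → N < k * size (rest R) → ∃ λ x → T (W′ x) × N ≤ k * k * k * outdeg E (rest R) x
    rich R lt with any? (λ x → T? (W′ x) ×-dec (N ≤? k * k * k * outdeg E (rest R) x))
    ... | yes found = found
    ... | no none = ⊥-elim (<⇒≱ (*-monoʳ-< N {{>-nonZero G.N≥1}} lt) (begin
        N * (k * size Z)                ≡⟨ id₁ N k (size Z) ⟩
        k * (N * size Z)                ≤⟨ *-monoʳ-≤ k (edges-≥-indeg E W′ Z (k * k) N λ v z → indegree v (proj₁ (∖-elim W (dominated E R) z))) ⟩
        k * (k * k * edges E W′ Z)      ≡⟨ id₂ k (edges E W′ Z) ⟩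
        k * k * k * edges E W′ Z        ≤⟨ *edges≤-outdeg E W′ Z (k * k * k) N (λ u w → <⇒≤ (≰⇒> λ le → none (u , w , le))) ⟩
        N * size W′                     ≤⟨ *-monoʳ-≤ N (size-mono λ v p → proj₁ (∧-elim p)) ⟩
        N * N ∎))
      where
      Z = rest R
      id₁ : ∀ N k z → N * (k * z) ≡ k * (N * z)
      id₁ = solve-∀
      id₂ : ∀ k e → k * (k * k * e) ≡ k * k * k * e
      id₂ = solve-∀
    greedy : ∀ τ → State τ
    greedy zero = [] , z≤n , (λ ()) , inj₂ (≤-trans (≤-reflexive (+-identityʳ (k * k * k * size (rest []))))
      (*-monoʳ-≤ (k * k * k) (size-mono λ v p → proj₁ (∧-elim p))))
    greedy (suc τ) with greedy τ
    ... | R , len , good , inj₁ done = R , m≤n⇒m≤1+n len , good , inj₁ done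
    ... | R , len , good , inj₂ progress with N <? k * size (rest R)
    ... | no ¬lt = R , m≤n⇒m≤1+n len , good , inj₁ (≮⇒≥ ¬lt)
    ... | yes lt with rich R lt
    ... | x , wx , deg = x ∷ R , s≤s len , good′ , inj₂ (begin
        k * k * k * size (rest (x ∷ R)) + (N + τ * N)         ≤⟨ +-monoʳ-≤ (k * k * k * size (rest (x ∷ R))) (+-monoˡ-≤ (τ * N) deg) ⟩
        k * k * k * size (rest (x ∷ R)) + (k * k * k * outdeg E (rest R) x + τ * N) ≡⟨ id₁ (k * k * k) (size (rest (x ∷ R))) (outdeg E (rest R) x) (τ * N) ⟩
        k * k * k * (size (rest (x ∷ R)) + outdeg E (rest R) x) + τ * N ≤⟨ +-monoˡ-≤ (τ * N) (*-monoʳ-≤ (k * k * k) (size-disjoint left right apart)) ⟩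
        k * k * k * size (rest R) + τ * N                     ≤⟨ progress ⟩
        k * k * k * N ∎)
      where
      id₁ : ∀ q a d b → q * a + (q * d + b) ≡ q * (a + d) + b
      id₁ q a d b = trans (sym (+-assoc (q * a) (q * d) b)) (cong (_+ b) (sym (*-distribˡ-+ q a d)))
      left : rest (x ∷ R) ⊑ rest R
      left v p = let (w , ¬d) = ∖-elim W (dominated E (x ∷ R)) p in ∖-intro W (dominated E R) w (¬d ∘ ∨-introʳ {E x v})
      right : (λ v → rest R v ∧ E x v) ⊑ rest R
      right v p = proj₁ (∧-elim p)
      apart : ∀ v → T (rest (x ∷ R) v) → ¬ T (rest R v ∧ E x v)
      apart v p q = proj₂ (∖-elim W (dominated E (x ∷ R)) p) (∨-introˡ (proj₂ (∧-elim {rest R v} q)))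
      good′ : ∀ {r} → r ∈ x ∷ R → T (W r) × r ∉ S
      good′ (here refl) = let (w , ¬l) = ∖-elim W (listed S) wx in w , λ x∈ → ¬l (fromWitness x∈)
      good′ (there r∈)  = good r∈
    finish : State (k * k * k) → ∃ λ R → length R ≤ k * k * k × (∀ {r} → r ∈ R → T (W r) × r ∉ S) × k * size (rest R) ≤ N
    finish (R , len , good , inj₁ done) = R , len , good , done
    -- After k³ rounds of full progress no vertex is left uncovered.
    finish (R , len , good , inj₂ full) = R , len , good , ≤-trans (begin
        k * size (rest R)           ≤⟨ *-monoˡ-≤ (size (rest R)) (m≤n*m k (k * k) {{m*n≢0 k k}}) ⟩
        k * k * k * size (rest R)   ≤⟨ +-cancelʳ-≤ (k * k * k * N) _ 0 full ⟩
        0 ∎) z≤n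

  -- Grown backwards from y: the first vertex has at least s in-neighbours in Y and fewer than s
  -- vertices are used so far. The exit from y to z is fixed beforehand.
  dense⇒path : ∀ {n} (E : Rel n) {Y s} → (∀ v → T (Y v) → s ≤ outdeg (flip E) Y v) → ∀ {y z} → T (Y y) → T (E y z) →
    ∀ j → j < s → ∃ λ x → ∃ λ acc → Walk E x acc z × Unique (x ∷ acc) × (∀ {v} → v ∈ x ∷ acc → T (Y v)) × length acc ≡ j
  dense⇒path E dense {y} yY e zero _ = y , [] , edge e , [] ∷ [] , (λ { (here refl) → yY }) , refl
  dense⇒path E {Y} {s} dense yY e (suc j) lt with dense⇒path E dense yY e j (<⇒≤ lt)
  ... | x , acc , walk , uniq , sub , len with pick {A = λ v → Y v ∧ E v x} (x ∷ acc)
          (≤-trans (s≤s (s≤s (≤-reflexive len))) (≤-trans lt (dense x (sub (here refl)))))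
  ... | x′ , p , x′∉ = x′ , x ∷ acc , proj₂ (∧-elim {Y x′} p) ∷ walk , ∉⇒All≢ x′∉ ∷ uniq , sub′ , cong suc len
    where
    sub′ : ∀ {v} → v ∈ x′ ∷ x ∷ acc → T (Y v)
    sub′ (here refl) = proj₁ (∧-elim p)
    sub′ (there v∈)  = sub v∈

  -- Fixes one witness per element of R and gathers them all in U, so that a later construction can
  -- avoid every choice at once.
  collect : ∀ {A B : Set} (P : A → List B → Set) L R → (∀ {r} → r ∈ R → ∃ λ zs → length zs ≤ L × P r zs) →
    ∃ λ U → length U ≤ length R * L × (∀ {r} → r ∈ R → ∃ λ zs → (∀ {x} → x ∈ zs → x ∈ U) × P r zs)
  collect P L [] f = [] , z≤n , λ ()
  collect {A} {B} P L (r ∷ R) f with f (here refl) | collect P L R (f ∘ there)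
  ... | zs , len , p | U , lenU , g = zs ++ U , ≤-trans (≤-reflexive (length-++ zs)) (+-mono-≤ len lenU) , h
    where
    h : ∀ {q} → q ∈ r ∷ R → ∃ λ ys → (∀ {x} → x ∈ ys → x ∈ zs ++ U) × P q ys
    h (here refl) = zs , ∈-++⁺ˡ , p
    h (there q∈)  = let (ys , sub , p′) = g q∈ in ys , ∈-++⁺ʳ zs ∘ sub , p′

  module _ {n} {E : Rel n} where

    relax : ∀ {W W′ S S′ u v L} → W′ ⊑ W → (∀ {x} → x ∈ S → x ∈ S′) → Conn E W′ S′ u v L → Conn E W S u v L
    relax sub incl (zs , walk , uniq , avoid , len) =
      zs , walk , uniq , (λ x∈ → sub _ (proj₁ (avoid x∈)) , λ x∈S → proj₂ (avoid x∈) (incl x∈S)) , len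

    compose : ∀ {W S u w v L₁ L₂} (p : Conn E W S u w L₁) (r : Conn E W S w v L₂) → T (W w) → w ∉ S →
      w ∉ proj₁ p → w ∉ proj₁ r → (∀ {x} → x ∈ proj₁ p → x ∉ proj₁ r) → Conn E W S u v (L₁ + suc L₂)
    compose {W} {S} {w = w} (zs₁ , walk₁ , uniq₁ , avoid₁ , len₁) (zs₂ , walk₂ , uniq₂ , avoid₂ , len₂) ww w∉S w∉₁ w∉₂ apart =
      zs₁ ++ w ∷ zs₂ , join walk₁ walk₂ , Uniq.++⁺ uniq₁ (∉⇒All≢ w∉₂ ∷ uniq₂) disjoint , avoid ,
      trans (length-++ zs₁) (cong₂ (λ i j → i + suc j) len₁ len₂)
      where
      disjoint : ∀ {x} → ¬ (x ∈ zs₁ × x ∈ w ∷ zs₂)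
      disjoint (x∈ , here refl) = w∉₁ x∈
      disjoint (x∈ , there x∈₂) = apart x∈ x∈₂
      avoid : ∀ {x} → x ∈ zs₁ ++ w ∷ zs₂ → T (W x) × x ∉ S
      avoid x∈ with ∈-++⁻ zs₁ x∈
      ... | inj₁ x∈₁         = avoid₁ x∈₁
      ... | inj₂ (here refl) = ww , w∉S
      ... | inj₂ (there x∈₂) = avoid₂ x∈₂

  ShortPaths : ∀ {n} → Rel n → ℕ → VSet n → ℕ → Set
  ShortPaths E k W t = ∀ {u v} → T (W u) → T (W v) → ∀ i S → length S + (i + 2 * k) ≤ t →
    ∃ λ d → d + 2 ≤ 2 * k × Conn E W S u v (suc (i + d))

  -- The route is a to g in W, g to h in W′, h to b in W. The outer parts have lengths uncertain by
  -- about 2q each; the middle part is lengthened to compensate, so that only the uncertainty d of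
  -- the k-piece remains.
  tuned-connector : ∀ {n} (E : Rel n) {q k W W′ t} → ShortPaths E q W t → ShortPaths E k W′ t → W′ ⊑ W →
    12 * q + 2 * k + 20 ≤ t → 4 ≤ size W′ → ∀ {a b} → T (W a) → T (W b) →
    ∃ λ d → d + 2 ≤ 2 * k × Conn E W (a ∷ b ∷ []) a b (4 * q + 1 + d)
  tuned-connector {n} E {q} {k} {W} {W′} {t} pathsW pathsW′ sub room 4≤size {a} {b} wa wb =
    choose₁ (pick {A = W′} (a ∷ b ∷ []) (<⇒≤ 4≤size))
    where
    open ≤-Reasoning
    Result : Set
    Result = ∃ λ d → d + 2 ≤ 2 * k × Conn E W (a ∷ b ∷ []) a b (4 * q + 1 + d)
    module Through {g h} (wg : T (W′ g)) (g∉ : g ∉ a ∷ b ∷ []) (wh : T (W′ h)) (h∉ : h ∉ g ∷ a ∷ b ∷ []) where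
      S : List (Fin n)
      S = h ∷ g ∷ a ∷ b ∷ []
      finish : ∀ {d₁ d₂} → d₁ + 2 ≤ 2 * q → d₂ + 2 ≤ 2 * q → (p : Conn E W S a g (suc d₁)) (r : Conn E W (proj₁ p ++ S) h b (suc d₂)) → Result
      finish {d₁} {d₂} d₁< d₂< p@(zs₁ , _ , _ , avoid₁ , len₁) r@(zs₂ , _ , _ , avoid₂ , len₂) =
        assemble (pathsW′ wg wh i (zs₂ ++ zs₁ ++ S) fit)
        where
        d₁+d₂ : d₁ + d₂ + 4 ≤ 4 * q
        d₁+d₂ = begin
          d₁ + d₂ + 4           ≡⟨ id₁ d₁ d₂ ⟩
          d₁ + 2 + (d₂ + 2)     ≤⟨ +-mono-≤ d₁< d₂< ⟩
          2 * q + 2 * q         ≡⟨ *-distribʳ-+ q 2 2 ⟨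
          4 * q ∎
          where
          id₁ : ∀ a b → a + b + 4 ≡ a + 2 + (b + 2)
          id₁ = solve-∀
        -- Chosen so that the three interiors and the junctions g, h add up to 4q + 1 + d.
        i = 4 * q ∸ (d₁ + d₂ + 4)
        i≡ : d₁ + d₂ + 4 + i ≡ 4 * q
        i≡ = m+[n∸m]≡n d₁+d₂
        fit : length (zs₂ ++ zs₁ ++ S) + (i + 2 * k) ≤ t
        fit = begin
          length (zs₂ ++ zs₁ ++ S) + (i + 2 * k)              ≡⟨ cong (_+ (i + 2 * k)) (trans (length-++ zs₂) (cong₂ _+_ len₂ (trans (length-++ zs₁) (cong (_+ 4) len₁)))) ⟩
          suc d₂ + (suc d₁ + 4) + (i + 2 * k)                 ≡⟨ id₁ d₁ d₂ i k ⟩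
          d₁ + d₂ + 4 + i + (2 + 2 * k)                       ≡⟨ cong (_+ (2 + 2 * k)) i≡ ⟩
          4 * q + (2 + 2 * k)                                 ≤⟨ m≤m+n _ (8 * q + 18) ⟩
          4 * q + (2 + 2 * k) + (8 * q + 18)                  ≡⟨ id₂ q k ⟩
          12 * q + 2 * k + 20                                 ≤⟨ room ⟩
          t ∎
          where
          id₁ : ∀ d₁ d₂ i k → suc d₂ + (suc d₁ + 4) + (i + 2 * k) ≡ d₁ + d₂ + 4 + i + (2 + 2 * k)
          id₁ = solve-∀
          id₂ : ∀ q k → 4 * q + (2 + 2 * k) + (8 * q + 18) ≡ 12 * q + 2 * k + 20
          id₂ = solve-∀
        assemble : (∃ λ d → d + 2 ≤ 2 * k × Conn E W′ (zs₂ ++ zs₁ ++ S) g h (suc (i + d))) → Result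
        assemble (d , d< , m@(zs₃ , _ , _ , avoid₃ , _)) = d , d< , subst (Conn E W (a ∷ b ∷ []) a b) length≡
          (compose (relax (λ _ w → w) (there ∘ there) p)
            (compose (relax sub (∈-++⁺ʳ zs₂ ∘ ∈-++⁺ʳ zs₁ ∘ there ∘ there) m) (relax (λ _ w → w) (∈-++⁺ʳ zs₁ ∘ there ∘ there) r)
              (sub h wh) (h∉ ∘ there) (λ h∈ → proj₂ (avoid₃ h∈) (∈-++⁺ʳ zs₂ (∈-++⁺ʳ zs₁ (here refl))))
              (λ h∈ → proj₂ (avoid₂ h∈) (∈-++⁺ʳ zs₁ (here refl))) (λ x∈₃ x∈₂ → proj₂ (avoid₃ x∈₃) (∈-++⁺ˡ x∈₂)))
            (sub g wg) g∉ (λ g∈ → proj₂ (avoid₁ g∈) (there (here refl))) g∉rest apart)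
          where
          g∉rest : g ∉ zs₃ ++ h ∷ zs₂
          g∉rest g∈ with ∈-++⁻ zs₃ g∈
          ... | inj₁ g∈₃          = proj₂ (avoid₃ g∈₃) (∈-++⁺ʳ zs₂ (∈-++⁺ʳ zs₁ (there (here refl))))
          ... | inj₂ (here refl)  = h∉ (here refl)
          ... | inj₂ (there g∈₂)  = proj₂ (avoid₂ g∈₂) (∈-++⁺ʳ zs₁ (there (here refl)))
          apart : ∀ {x} → x ∈ zs₁ → x ∉ zs₃ ++ h ∷ zs₂
          apart x∈ x∈r with ∈-++⁻ zs₃ x∈r
          ... | inj₁ x∈₃          = proj₂ (avoid₃ x∈₃) (∈-++⁺ʳ zs₂ (∈-++⁺ˡ x∈))
          ... | inj₂ (here refl)  = proj₂ (avoid₁ x∈) (here refl)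
          ... | inj₂ (there x∈₂)  = proj₂ (avoid₂ x∈₂) (∈-++⁺ˡ x∈)
          length≡ : suc d₁ + suc (suc (i + d) + suc (suc d₂)) ≡ 4 * q + 1 + d
          length≡ = trans (id₁ d₁ d₂ i d) (cong (λ x → x + 1 + d) i≡)
            where
            id₁ : ∀ d₁ d₂ i d → suc d₁ + suc (suc (i + d) + suc (suc d₂)) ≡ d₁ + d₂ + 4 + i + 1 + d
            id₁ = solve-∀
      fit₁ : length S + (0 + 2 * q) ≤ t
      fit₁ = ≤-trans (≤-trans (m≤m+n _ (10 * q + 2 * k + 16)) (≤-reflexive (id₁ q k))) room
        where
        id₁ : ∀ q k → 4 + (0 + 2 * q) + (10 * q + 2 * k + 16) ≡ 12 * q + 2 * k + 20
        id₁ = solve-∀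
      fit₂ : ∀ {d₁} → d₁ + 2 ≤ 2 * q → (p : Conn E W S a g (suc d₁)) → length (proj₁ p ++ S) + (0 + 2 * q) ≤ t
      fit₂ {d₁} d₁< (zs₁ , _ , _ , _ , len₁) = begin
        length (zs₁ ++ S) + (0 + 2 * q)                     ≡⟨ cong (_+ (0 + 2 * q)) (trans (length-++ zs₁) (cong (_+ 4) len₁)) ⟩
        suc d₁ + 4 + (0 + 2 * q)                            ≡⟨ id₁ d₁ q ⟩
        d₁ + 2 + 3 + 2 * q                                  ≤⟨ +-monoˡ-≤ (2 * q) (+-monoˡ-≤ 3 d₁<) ⟩
        2 * q + 3 + 2 * q                                   ≤⟨ m≤m+n _ (8 * q + 2 * k + 17) ⟩
        2 * q + 3 + 2 * q + (8 * q + 2 * k + 17)            ≡⟨ id₂ q k ⟩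
        12 * q + 2 * k + 20                                 ≤⟨ room ⟩
        t ∎
        where
        id₁ : ∀ d q → suc d + 4 + (0 + 2 * q) ≡ d + 2 + 3 + 2 * q
        id₁ = solve-∀
        id₂ : ∀ q k → 2 * q + 3 + 2 * q + (8 * q + 2 * k + 17) ≡ 12 * q + 2 * k + 20
        id₂ = solve-∀
      second : (∃ λ d₁ → d₁ + 2 ≤ 2 * q × Conn E W S a g (suc d₁)) → Result
      second (d₁ , d₁< , p) = let (d₂ , d₂< , r) = pathsW (sub h wh) wb 0 (proj₁ p ++ S) (fit₂ d₁< p) in finish d₁< d₂< p r
      result : Result
      result = second (pathsW wa (sub g wg) 0 S fit₁)
    choose₂ : ∀ {g} → T (W′ g) → g ∉ a ∷ b ∷ [] → (∃ λ h → T (W′ h) × h ∉ g ∷ a ∷ b ∷ []) → Result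
    choose₂ wg g∉ (h , wh , h∉) = Through.result wg g∉ wh h∉
    choose₁ : (∃ λ g → T (W′ g) × g ∉ a ∷ b ∷ []) → Result
    choose₁ (g , wg , g∉) = choose₂ wg g∉ (pick {A = W′} (g ∷ a ∷ b ∷ []) 4≤size)

  -- Cycles

  lookup-injective : ∀ {A : Set} {xs : List A} → Unique xs → ∀ {i j} → lookup xs i ≡ lookup xs j → i ≡ j
  lookup-injective (_ ∷ _) {zero}  {zero}  _  = refl
  lookup-injective (p ∷ _) {zero}  {suc j} eq = ⊥-elim (All-lookup p (∈-lookup j) eq)
  lookup-injective (p ∷ _) {suc i} {zero}  eq = ⊥-elim (All-lookup p (∈-lookup i) (sym eq))
  lookup-injective (_ ∷ q) {suc i} {suc j} eq = cong suc (lookup-injective q eq)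

  walk-steps : ∀ {n} {E : Rel n} {u xs v} → Walk E u xs v → ∀ (i : Fin (length xs)) →
    T (E (lookup (u ∷ xs) (inject₁ i)) (lookup (u ∷ xs) (suc i)))
  walk-steps (e ∷ w) zero    = e
  walk-steps (e ∷ w) (suc i) = walk-steps w i

  walk-last : ∀ {n} {E : Rel n} {u xs v} → Walk E u xs v → T (E (lookup (u ∷ xs) (fromℕ (length xs))) v)
  walk-last (edge e) = e
  walk-last (e ∷ w)  = walk-last w

  closed⇒cycle : ∀ {n} {E : Rel n} {v zs} → Walk E v zs v → Unique (v ∷ zs) → 1 ≤ length zs → HasCycleRel E (suc (length zs))
  closed⇒cycle {v = v} {zs} walk uniq ≥1 = length zs , refl , ≥1 , lookup (v ∷ zs) , lookup-injective uniq , walk-steps walk , walk-last walk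

  NearCycle : ∀ {n} → Rel n → ℕ → ℕ → Set
  NearCycle E m r = ∃ λ ℓ → m ≤ ℓ × ℓ ∸ m ≤ r × HasCycleRel E ℓ

  -- The bound q³ on S equals the bound on R, so a second list can be chosen disjoint from the
  -- first.
  Dominating : ∀ {n} → Rel n → ℕ → VSet n → Set
  Dominating E q W = ∀ S → length S ≤ q * q * q →
    ∃ λ R → length R ≤ q * q * q × (∀ {r} → r ∈ R → T (W r) × r ∉ S) × q * size (W ∖ dominated E R) ≤ size W

  module _ {n} (E : Rel n) {q k t : ℕ} (room : 12 * q + 2 * k + 20 ≤ t) where

    short-cycle : ∀ {W} → ShortPaths E k W t → 1 ≤ size W → ∀ m → m ≤ 4 * q + 3 → NearCycle E m (2 * k)
    short-cycle {W} paths nonempty m m≤ = around (pick {A = W} [] nonempty)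
      where
      open ≤-Reasoning
      -- A closed path with `suc (i + d)` interior vertices gives a cycle of length 2 + i + d. For m
      -- < 2 the subtraction truncates, and the margin in d + 2 ≤ 2k absorbs the difference.
      i = m ∸ 2
      fit : 1 + (i + 2 * k) ≤ t
      fit = begin
        1 + (i + 2 * k)              ≤⟨ s≤s (+-monoˡ-≤ (2 * k) (≤-trans (m∸n≤m m 2) m≤)) ⟩
        1 + (4 * q + 3 + 2 * k)      ≤⟨ m≤m+n _ (8 * q + 16) ⟩
        1 + (4 * q + 3 + 2 * k) + (8 * q + 16) ≡⟨ id₁ q k ⟩
        12 * q + 2 * k + 20          ≤⟨ room ⟩
        t ∎
        where
        id₁ : ∀ q k → 1 + (4 * q + 3 + 2 * k) + (8 * q + 16) ≡ 12 * q + 2 * k + 20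
        id₁ = solve-∀
      close : ∀ {v} → (∃ λ d → d + 2 ≤ 2 * k × Conn E W (v ∷ []) v v (suc (i + d))) → NearCycle E m (2 * k)
      close (d , d< , zs , walk , uniq , avoid , len) =
        suc (length zs) , ≤-trans (m≤n+m∸n m 2) (≤-trans (m≤m+n _ d) (≤-reflexive (sym length≡))) , over ,
        closed⇒cycle walk (∉⇒All≢ (λ v∈ → proj₂ (avoid v∈) (here refl)) ∷ uniq) (≤-trans (s≤s z≤n) (≤-reflexive (sym len)))
        where
        length≡ : suc (length zs) ≡ 2 + i + d
        length≡ = cong suc len
        over : suc (length zs) ∸ m ≤ 2 * k
        over = begin
          suc (length zs) ∸ m     ≡⟨ cong (_∸ m) length≡ ⟩
          2 + i + d ∸ m           ≤⟨ m≤n+o⇒m∸n≤o _ m (begin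
            2 + (m ∸ 2) + d         ≤⟨ +-monoˡ-≤ d (+-monoʳ-≤ 2 (m∸n≤m m 2)) ⟩
            2 + m + d               ≡⟨ id₁ m d ⟩
            m + (d + 2)             ≤⟨ +-monoʳ-≤ m d< ⟩
            m + 2 * k ∎) ⟩
          2 * k ∎
          where
          id₁ : ∀ m d → 2 + m + d ≡ m + (d + 2)
          id₁ m d = trans (cong (_+ d) (+-comm 2 m)) (trans (+-assoc m 2 d) (cong (m +_) (+-comm 2 d)))
      around : (∃ λ v → T (W v) × v ∉ []) → NearCycle E m (2 * k)
      around (v , wv , _) = close (paths wv wv i (v ∷ []) fit)

    Connector : Fin n → Fin n → List (Fin n) → Set
    Connector a b zs = ∃ λ d → d + 2 ≤ 2 * k × Walk E a zs b × Unique zs × (∀ {x} → x ∈ zs → x ∉ a ∷ b ∷ []) × length zs ≡ 4 * q + 1 + d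

    -- `U₀` bounds the interiors of the q³ · q³ connectors from R₂ to R₁, each of at most 4q + 1 +
    -- 2k vertices, together with both lists.
    module LongCycle {W W′} (pathsW : ShortPaths E q W t) (pathsW′ : ShortPaths E k W′ t) (sub : W′ ⊑ W) (4≤size : 4 ≤ size W′)
                     (R₁ R₂ : List (Fin n)) (R₁-len : length R₁ ≤ q * q * q) (R₂-len : length R₂ ≤ q * q * q)
                     (R₁⊑W : ∀ {r} → r ∈ R₁ → T (W r) × r ∉ []) (R₂⊑W : ∀ {r} → r ∈ R₂ → T (W r) × r ∉ R₁)
                     (uncovered₁ : q * size (W ∖ dominated E R₁) ≤ size W) (uncovered₂ : q * size (W ∖ dominated (flip E) R₂) ≤ size W)
                     {U₀} (U₀-room : q * q * q * (q * q * q * (4 * q + 1 + 2 * k)) + (q * q * q + q * q * q) ≤ U₀)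
                     (s : ℕ) (s≥1 : 1 ≤ s) where

      open ≤-Reasoning

      N Lmax : ℕ
      N = size W
      Lmax = 4 * q + 1 + 2 * k

      connector : ∀ {a} → a ∈ R₂ → ∀ {b} → b ∈ R₁ → ∃ λ zs → length zs ≤ Lmax × Connector a b zs
      connector a∈ b∈ = bounded (tuned-connector E {q} {k} {W} {W′} {t} pathsW pathsW′ sub room 4≤size (proj₁ (R₂⊑W a∈)) (proj₁ (R₁⊑W b∈)))
        where
        bounded : ∀ {a b} → (∃ λ d → d + 2 ≤ 2 * k × Conn E W (a ∷ b ∷ []) a b (4 * q + 1 + d)) → ∃ λ zs → length zs ≤ Lmax × Connector a b zs
        bounded (d , d< , zs , walk , uniq , avoid , len) =
          zs , ≤-trans (≤-reflexive len) (+-monoʳ-≤ (4 * q + 1) (≤-trans (m≤m+n d 2) d<)) ,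
          d , d< , walk , uniq , (λ x∈ → proj₂ (avoid x∈)) , len

      ConnectorsFrom : Fin n → List (Fin n) → Set
      ConnectorsFrom a U = ∀ {b} → b ∈ R₁ → ∃ λ zs → (∀ {x} → x ∈ zs → x ∈ U) × Connector a b zs

      connectors-from : ∀ {a} → a ∈ R₂ → ∃ λ U → length U ≤ q * q * q * Lmax × ConnectorsFrom a U
      connectors-from {a} a∈ = let (U , len , f) = collect (Connector a) Lmax R₁ (connector a∈) in U , ≤-trans len (*-monoˡ-≤ Lmax R₁-len) , f

      all-connectors : ∃ λ V → length V ≤ length R₂ * (q * q * q * Lmax) ×
        (∀ {a} → a ∈ R₂ → ∃ λ U → (∀ {x} → x ∈ U → x ∈ V) × ConnectorsFrom a U)
      all-connectors = collect ConnectorsFrom (q * q * q * Lmax) R₂ connectors-from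

      module Outside (V : List (Fin n)) (V-len : length V ≤ length R₂ * (q * q * q * Lmax))
                     (connects : ∀ {a} → a ∈ R₂ → ∃ λ U → (∀ {x} → x ∈ U → x ∈ V) × ConnectorsFrom a U) where

        U : List (Fin n)
        U = V ++ R₁ ++ R₂

        U-len : length U ≤ U₀
        U-len = begin
          length (V ++ R₁ ++ R₂)                ≡⟨ trans (length-++ V) (cong (length V +_) (length-++ R₁)) ⟩
          length V + (length R₁ + length R₂)    ≤⟨ +-mono-≤ (≤-trans V-len (*-monoˡ-≤ (q * q * q * Lmax) R₂-len)) (+-mono-≤ R₁-len R₂-len) ⟩
          q * q * q * (q * q * q * Lmax) + (q * q * q + q * q * q) ≤⟨ U₀-room ⟩
          U₀ ∎

        D₁ D₂ X : VSet n
        D₁ = dominated E R₁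
        D₂ = dominated (flip E) R₂
        -- A path inside X can be entered from R₁, left towards R₂, and meets no connector.
        X = (W ∖ listed U) ∩ D₁ ∩ D₂

        X⁻ : ∀ {v} → T (X v) → (T (W v) × ¬ T (listed U v)) × T (D₁ v) × T (D₂ v)
        X⁻ {v} p = let (w , d) = ∧-elim {(W ∖ listed U) v} p in ∖-elim W (listed U) w , ∧-elim d

        X⊑W : X ⊑ W
        X⊑W v p = proj₁ (proj₁ (X⁻ p))

        lost : q * size (W ∖ X) ≤ q * U₀ + 2 * N
        lost = begin
          q * size (W ∖ X)                                              ≤⟨ *-monoʳ-≤ q (size-cover {A = listed U} {(W ∖ D₁) ∪ (W ∖ D₂)} classify) ⟩
          q * (size (listed U) + size ((W ∖ D₁) ∪ (W ∖ D₂)))            ≤⟨ *-monoʳ-≤ q (+-mono-≤ (≤-trans (size-listed U) U-len) (size-∪ (W ∖ D₁) (W ∖ D₂))) ⟩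
          q * (U₀ + (size (W ∖ D₁) + size (W ∖ D₂)))                    ≡⟨ id₁ q U₀ (size (W ∖ D₁)) (size (W ∖ D₂)) ⟩
          q * U₀ + (q * size (W ∖ D₁) + (q * size (W ∖ D₂) + 0))        ≤⟨ +-monoʳ-≤ (q * U₀) (+-mono-≤ uncovered₁ (+-monoˡ-≤ 0 uncovered₂)) ⟩
          q * U₀ + 2 * N ∎
          where
          id₁ : ∀ q u a b → q * (u + (a + b)) ≡ q * u + (q * a + (q * b + 0))
          id₁ = solve-∀
          classify : ∀ v → T ((W ∖ X) v) → T (listed U v) ⊎ T (((W ∖ D₁) ∪ (W ∖ D₂)) v)
          classify v p with ∖-elim W X p | T? (listed U v) | T? (D₁ v) | T? (D₂ v)
          ... | w , _  | yes l | _     | _      = inj₁ l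
          ... | w , _  | no _  | no ¬d | _      = inj₂ (∨-introˡ (∖-intro W D₁ w ¬d))
          ... | w , _  | no _  | yes _ | no ¬d  = inj₂ (∨-introʳ {(W ∖ D₁) v} (∖-intro W D₂ w ¬d))
          ... | w , ¬x | no ¬l | yes d | yes d′ = ⊥-elim (¬x (∧-intro (∖-intro W (listed U) w ¬l) (∧-intro d d′)))

        -- The s path vertices, a, b and the 4q + 1 guaranteed interior vertices of a connector.
        m : ℕ
        m = s + (4 * q + 3)

        -- The cycle runs from b along the path in X to a and back to b by the connector. That a
        -- differs from b holds because R₂ avoids R₁.
        assemble : ∀ {Y} → Y ⊑ X → ∀ {a b x acc zs Ua} → a ∈ R₂ → b ∈ R₁ → T (E b x) → Walk E x acc a → Unique (x ∷ acc) →
          (∀ {v} → v ∈ x ∷ acc → T (Y v)) → length acc ≡ s ∸ 1 → (∀ {x} → x ∈ Ua → x ∈ V) → (∀ {x} → x ∈ zs → x ∈ Ua) →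
          Connector a b zs → NearCycle E m (2 * k)
        assemble Y⊑X {a} {b} {x} {acc} {zs} a∈ b∈ bx path uniqP P⊑Y lenP Ua⊆ zs⊆ (d , d< , walk , uniq , avoid , len) =
          suc (length P′) , ≤-trans (m≤m+n _ d) (≤-reflexive (sym length≡)) , over ,
          closed⇒cycle (join (bx ∷ path) walk) (∉⇒All≢ b∉ ∷ Uniq.++⁺ uniqP (∉⇒All≢ (λ a∈zs → avoid a∈zs (here refl)) ∷ uniq) disjoint) (s≤s z≤n)
          where
          P P′ : List (Fin n)
          P = x ∷ acc
          P′ = P ++ a ∷ zs
          P∉U : ∀ {v} → v ∈ P → v ∉ U
          P∉U v∈ v∈U = proj₂ (proj₁ (X⁻ (Y⊑X _ (P⊑Y v∈)))) (fromWitness v∈U)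
          b∉ : b ∉ P′
          b∉ b∈P′ with ∈-++⁻ P b∈P′
          ... | inj₁ b∈P          = P∉U b∈P (∈-++⁺ʳ V (∈-++⁺ˡ b∈))
          ... | inj₂ (here refl)  = proj₂ (R₂⊑W a∈) b∈
          ... | inj₂ (there b∈zs) = avoid b∈zs (there (here refl))
          disjoint : ∀ {v} → ¬ (v ∈ P × v ∈ a ∷ zs)
          disjoint (v∈ , here refl)   = P∉U v∈ (∈-++⁺ʳ V (∈-++⁺ʳ R₁ a∈))
          disjoint (v∈ , there v∈zs)  = P∉U v∈ (∈-++⁺ˡ (Ua⊆ (zs⊆ v∈zs)))
          length≡ : suc (length P′) ≡ m + d
          length≡ = begin-equality
            suc (length (P ++ a ∷ zs))          ≡⟨ cong suc (length-++ P) ⟩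
            suc (suc (length acc) + suc (length zs)) ≡⟨ cong₂ (λ i j → suc (suc i + suc j)) lenP len ⟩
            suc (suc (s ∸ 1) + suc (4 * q + 1 + d)) ≡⟨ cong (λ i → suc (i + suc (4 * q + 1 + d))) (m+[n∸m]≡n s≥1) ⟩
            suc (s + suc (4 * q + 1 + d))       ≡⟨ arith s q d ⟩
            s + (4 * q + 3) + d ∎
            where
            arith : ∀ s q d → suc (s + suc (4 * q + 1 + d)) ≡ s + (4 * q + 3) + d
            arith = solve-∀
          over : suc (length P′) ∸ m ≤ 2 * k
          over = ≤-trans (≤-reflexive (trans (cong (_∸ m) length≡) (m+n∸m≡n m d))) (≤-trans (m≤m+n d 2) d<)

        -- The exit a is fixed by y, but the entry b is known only once the path is built. This is
        -- why connectors are prepared for all pairs before the path is chosen.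
        from-dense : (∃ λ Y → Y ⊑ X × (∃ λ y → T (Y y)) × (∀ v → T (Y v) → s ≤ outdeg (flip E) Y v)) → NearCycle E m (2 * k)
        from-dense (Y , Y⊑X , (y , yY) , dense) =
          let (a , a∈ , ya) = dominated⁻ (flip E) R₂ (proj₂ (proj₂ (X⁻ (Y⊑X y yY))))
              (x , acc , path , uniqP , P⊑Y , lenP) = dense⇒path E dense yY ya (s ∸ 1) (≤-reflexive (m+[n∸m]≡n s≥1))
              (b , b∈ , bx) = dominated⁻ E R₁ (proj₁ (proj₂ (X⁻ (Y⊑X x (P⊑Y (here refl))))))
              (Ua , Ua⊆ , f) = connects a∈
              (zs , zs⊆ , c) = f b∈
          in assemble Y⊑X a∈ b∈ bx path uniqP P⊑Y lenP Ua⊆ zs⊆ c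

        -- X is ordered by peeling at s per vertex; the vertices outside X, about U₀ + 2N/q in
        -- number, are discarded at cost N each.
        from-peeling : Fb E X (s * size X) → ∃ λ b → Fb E W b × q * b ≤ (q * (s + U₀) + 2 * N) * N
        from-peeling fb = s * size X + size (W ∖ X) * N , Fb-discard E X⊑W fb , (begin
            q * (s * size X + size (W ∖ X) * N)        ≡⟨ id₁ q s (size X) (size (W ∖ X)) N ⟩
            q * s * size X + q * size (W ∖ X) * N      ≤⟨ +-mono-≤ (*-monoʳ-≤ (q * s) (size-mono X⊑W)) (*-monoˡ-≤ N lost) ⟩
            q * s * N + (q * U₀ + 2 * N) * N           ≡⟨ id₂ q s U₀ N ⟩
            (q * (s + U₀) + 2 * N) * N ∎)
            where
            id₁ : ∀ q s x y N → q * (s * x + y * N) ≡ q * s * x + q * y * N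
            id₁ = solve-∀
            id₂ : ∀ q s u N → q * s * N + (q * u + 2 * N) * N ≡ (q * (s + u) + 2 * N) * N
            id₂ = solve-∀

        result : NearCycle E m (2 * k) ⊎ ∃ λ b → Fb E W b × q * b ≤ (q * (s + U₀) + 2 * N) * N
        result = [ inj₂ ∘ from-peeling , inj₁ ∘ from-dense ]′ (peel E s X)

      result : NearCycle E (s + (4 * q + 3)) (2 * k) ⊎ ∃ λ b → Fb E W b × q * b ≤ (q * (s + U₀) + 2 * N) * N
      result = let (V , V-len , connects) = all-connectors in Outside.result V V-len connects

    long-cycle : ∀ {W W′} → ShortPaths E q W t → ShortPaths E k W′ t → W′ ⊑ W → 4 ≤ size W′ →
      Dominating E q W → Dominating (flip E) q W →
      ∀ {U₀} → q * q * q * (q * q * q * (4 * q + 1 + 2 * k)) + (q * q * q + q * q * q) ≤ U₀ → ∀ s → 1 ≤ s →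
      NearCycle E (s + (4 * q + 3)) (2 * k) ⊎ ∃ λ b → Fb E W b × q * b ≤ (q * (s + U₀) + 2 * size W) * size W
    long-cycle {W} {W′} pathsW pathsW′ sub 4≤size dom₁ dom₂ U₀-room s s≥1 =
      let (R₁ , len₁ , R₁⊑W , cover₁) = dom₁ [] z≤n
          (R₂ , len₂ , R₂⊑W , cover₂) = dom₂ R₁ len₁
      in LongCycle.result {W} {W′} pathsW pathsW′ sub 4≤size R₁ R₂ len₁ len₂ R₁⊑W R₂⊑W cover₁ cover₂ U₀-room s s≥1

  -- Cycle or cheap ordering

  module _ {n} (E : Rel n) {q k t N₀ U₀} (q≥1 : 1 ≤ q) (k≥1 : 1 ≤ k) (room : 12 * q + 2 * k + 20 ≤ t)
           (k-large : 41 * (k * k * k * k * k * t) + 3 ≤ N₀) (q-large : 41 * (q * q * q * q * q * t) + 3 ≤ N₀)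
           (dom-large : 5 + q * q * (q * q * q) ≤ N₀)
           (U₀-room : q * q * q * (q * q * q * (4 * q + 1 + 2 * k)) + (q * q * q + q * q * q) ≤ U₀)
           {m c} (path-budget : q * (m + (N₀ + U₀)) + 2 * n ≤ q * c)
           (short-budget : 2 * (k * k) * (N₀ + U₀) + 5 * n ≤ 2 * (k * k) * c) where

    private
      t≥1 : 1 ≤ t
      t≥1 = ≤-trans (≤-trans (s≤s z≤n) (m≤n+m 20 (12 * q + 2 * k))) room

      5≤N₀ : 5 ≤ N₀
      5≤N₀ = ≤-trans (m≤m+n 5 (q * q * (q * q * q))) dom-large

      dominating : ∀ {W} (E : Rel n) → Robust q E W → N₀ ≤ size W → Dominating E q W
      dominating {W} E rob large S len = almost-dominating E {q} {W} rob {t} q≥1 t≥1 (≤-trans q-large large) S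
        (≤-trans (+-monoʳ-≤ 5 (*-monoʳ-≤ (q * q) len)) (≤-trans (≤-trans dom-large large) (m≤m+n (size W) (3 * size W))))

      N₀≤c : N₀ ≤ c
      N₀≤c = ≤-trans (m≤m+n N₀ U₀) (≤-trans (m≤n+m (N₀ + U₀) m) (*-cancelˡ-≤ q {{>-nonZero q≥1}} (≤-trans (m≤m+n _ (2 * n)) path-budget)))

      Core : VSet n → Set
      Core W = ∃ λ W′ → W′ ⊑ W × Robust k E W′ × N₀ ≤ size W′

      core-or-small : ∀ {W} W′ → W′ ⊑ W → Robust k E W′ → Core W ⊎ Fb E W′ (N₀ * size W′)
      core-or-small W′ sub rob with size W′ ≤? N₀
      ... | yes small = inj₂ (Fb-weaken E {W′} (*-monoˡ-≤ (size W′) small) (Fb-trivial E W′))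
      ... | no large  = inj₁ (W′ , sub , rob , <⇒≤ (≰⇒> large))

      -- Since |W| ≤ n, the quadratic cost 5|W|² becomes 5n|W|. A cost linear in |W|, at c per
      -- vertex, is what the outer decomposition can add up.
      without-core : ∀ {W} → (∃ λ β → Fb E W β × 2 * (k * k) * β ≤ 2 * (k * k) * (N₀ * size W) + 5 * (size W * size W)) → Fb E W (c * size W)
      without-core {W} (β , fb , le) = Fb-weaken E {W} (*-cancelˡ-≤ (2 * (k * k)) {{2k²≢0}} (begin
          2 * (k * k) * β                                              ≤⟨ le ⟩
          2 * (k * k) * (N₀ * N) + 5 * (N * N)                         ≤⟨ +-mono-≤ (*-monoʳ-≤ (2 * (k * k)) (*-monoˡ-≤ N (m≤m+n N₀ U₀))) (*-monoʳ-≤ 5 (*-monoˡ-≤ N (size≤n W))) ⟩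
          2 * (k * k) * ((N₀ + U₀) * N) + 5 * (n * N)                  ≡⟨ cong₂ _+_ (*-assoc (2 * (k * k)) (N₀ + U₀) N) (*-assoc 5 n N) ⟨
          2 * (k * k) * (N₀ + U₀) * N + 5 * n * N                      ≡⟨ *-distribʳ-+ N (2 * (k * k) * (N₀ + U₀)) (5 * n) ⟨
          (2 * (k * k) * (N₀ + U₀) + 5 * n) * N                        ≤⟨ *-monoˡ-≤ N short-budget ⟩
          2 * (k * k) * c * N                                          ≡⟨ *-assoc (2 * (k * k)) c N ⟩
          2 * (k * k) * (c * N) ∎)) fb
        where
        open ≤-Reasoning
        N = size W
        2k²≢0 : NonZero (2 * (k * k))
        2k²≢0 = m*n≢0 2 (k * k) {{_}} {{m*n≢0 k k {{>-nonZero k≥1}} {{>-nonZero k≥1}}}}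

      without-path : ∀ {W} → (∃ λ b → Fb E W b × q * b ≤ (q * (m ∸ (4 * q + 3) + U₀) + 2 * size W) * size W) → Fb E W (c * size W)
      without-path {W} (b , fb , le) = Fb-weaken E {W} (*-cancelˡ-≤ q {{>-nonZero q≥1}} (begin
          q * b                                                        ≤⟨ le ⟩
          (q * (m ∸ (4 * q + 3) + U₀) + 2 * N) * N                     ≤⟨ *-monoˡ-≤ N (+-mono-≤ (*-monoʳ-≤ q (+-mono-≤ (m∸n≤m m (4 * q + 3)) (m≤n+m U₀ N₀))) (*-monoʳ-≤ 2 (size≤n W))) ⟩
          (q * (m + (N₀ + U₀)) + 2 * n) * N                            ≤⟨ *-monoˡ-≤ N path-budget ⟩
          q * c * N                                                    ≡⟨ *-assoc q c N ⟩
          q * (c * N) ∎)) fb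
        where
        open ≤-Reasoning
        N = size W

      with-core : ∀ {W} → Robust q E W → N₀ ≤ size W → Core W → NearCycle E m (2 * k) ⊎ Fb E W (c * size W)
      with-core {W} robW large (W′ , sub , robW′ , large′) with m ≤? 4 * q + 3
      -- Up to 4q + 3 the length is bounded and the k-robust piece alone provides the cycle; beyond,
      -- s = m - (4q + 3) is positive.
      ... | yes short = inj₁ (short-cycle E {q} {k} room {W′} (connect E {k} {W′} robW′ k≥1 t≥1 (≤-trans k-large large′))
              (≤-trans (≤-trans (s≤s z≤n) 5≤N₀) large′) m short)
      ... | no long = [ inj₁ ∘ subst (λ x → NearCycle E x (2 * k)) (m∸n+n≡m (<⇒≤ (≰⇒> long))) , inj₂ ∘ without-path ]′
              (long-cycle E {q} {k} room {W} {W′} (connect E {q} {W} robW q≥1 t≥1 (≤-trans q-large large))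
                (connect E {k} {W′} robW′ k≥1 t≥1 (≤-trans k-large large′)) sub (≤-trans (≤-trans (m≤m+n 4 1) 5≤N₀) large′)
                (dominating {W} E robW large) (dominating {W} (flip E) (robust-flip E {q} {W} robW) large)
                U₀-room (m ∸ (4 * q + 3)) (m<n⇒0<n∸m (≰⇒> long)))

    -- Pieces of at most N₀ ≤ c vertices are cheap outright. In a larger one, cutting along k-sparse
    -- cuts either orders W within budget or exposes a large k-robust core.
    robust-case : ∀ {W} → Robust q E W → NearCycle E m (2 * k) ⊎ Fb E W (c * size W)
    robust-case {W} robW with size W ≤? N₀
    ... | yes small = inj₂ (Fb-weaken E {W} (*-monoˡ-≤ (size W) (≤-trans small N₀≤c)) (Fb-trivial E W))
    ... | no large  = [ with-core {W} robW (<⇒≤ (≰⇒> large)) , inj₂ ∘ without-core {W} ]′ (decompose E k N₀ {Core W} W core-or-small)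

  SmallFeedback : ℕ → ℕ → ℕ → ℕ → Set
  SmallFeedback q c n β = 2 * (q * q) * β ≤ 2 * (q * q) * (c * n) + 5 * (n * n)

  -- C is fixed before the digraph, m and c; the two inequalities say that c pays for peeling and
  -- for the inner decomposition.
  Dichotomy : ℕ → ℕ → ℕ → Set
  Dichotomy q k C = ∀ {n} (E : Rel n) m c → q * (m + C) + 2 * n ≤ q * c → 2 * (k * k) * C + 5 * n ≤ 2 * (k * k) * c →
    NearCycle E m (2 * k) ⊎ ∃ λ β → Fb E (λ _ → true) β × SmallFeedback q c n β

  -- Outer decomposition into q-robust pieces, each giving a cycle or an ordering at c per vertex.
  dichotomy : ∀ {q k t N₀ U₀} → 1 ≤ q → 1 ≤ k → 12 * q + 2 * k + 20 ≤ t →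
    41 * (k * k * k * k * k * t) + 3 ≤ N₀ → 41 * (q * q * q * q * q * t) + 3 ≤ N₀ → 5 + q * q * (q * q * q) ≤ N₀ →
    q * q * q * (q * q * q * (4 * q + 1 + 2 * k)) + (q * q * q + q * q * q) ≤ U₀ → Dichotomy q k (N₀ + U₀)
  dichotomy {q} {k} q≥1 k≥1 room k-large q-large dom-large U₀-room {n} E m c hq hk =
    [ inj₁ , inj₂ ∘ enlarge ]′ (decompose E q c (λ _ → true)
      λ W _ rob → robust-case E {q} {k} q≥1 k≥1 room k-large q-large dom-large U₀-room {m} {c} hq hk {W} rob)
    where
    all≤n : size {n} (λ _ → true) ≤ n
    all≤n = size≤n _
    enlarge : (∃ λ β → Fb E (λ _ → true) β × 2 * (q * q) * β ≤ 2 * (q * q) * (c * size {n} (λ _ → true)) + 5 * (size {n} (λ _ → true) * size {n} (λ _ → true))) →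
      ∃ λ β → Fb E (λ _ → true) β × SmallFeedback q c n β
    enlarge (β , fb , le) = β , fb , ≤-trans le (+-mono-≤ (*-monoʳ-≤ (2 * (q * q)) (*-monoʳ-≤ c all≤n)) (*-monoʳ-≤ 5 (*-mono-≤ all≤n all≤n)))

  near-cycle-or-small-feedback : ∀ q k → 1 ≤ q → 1 ≤ k → ∃ λ C → Dichotomy q k C
  near-cycle-or-small-feedback q k q≥1 k≥1 = constants _ _ _ ≤-refl ≤-refl ≤-refl
    where
    -- The constants enter as variables bounded from below; the sum x + (y + z) serves as N₀ for all
    -- three size conditions.
    constants : ∀ t x y → 12 * q + 2 * k + 20 ≤ t → 41 * (k * k * k * k * k * t) + 3 ≤ x → 41 * (q * q * q * q * q * t) + 3 ≤ y →
      ∃ λ C → Dichotomy q k C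
    constants t x y room k-large q-large = _ , dichotomy q≥1 k≥1 room
      (≤-trans k-large (m≤m+n x (y + z))) (≤-trans q-large (≤-trans (m≤m+n y z) (m≤n+m (y + z) x))) (≤-trans (m≤n+m z y) (m≤n+m (y + z) x)) ≤-refl
      where
      z = 5 + q * q * (q * q * q)

  -- Feedback arc sets as edge subsets

  sum-allFin : ∀ {n} (f : Fin n → ℕ) → ListAction.sum (List.map f (List.allFin n)) ≡ sum f
  sum-allFin f = trans (cong ListAction.sum (map-tabulate id f)) (sum-tabulate f)
    where
    sum-tabulate : ∀ {n} (f : Fin n → ℕ) → ListAction.sum (List.tabulate f) ≡ sum f
    sum-tabulate {zero}  f = refl
    sum-tabulate {suc n} f = cong (f zero +_) (sum-tabulate (f ∘ suc))

  opaque

    unfolding size pairs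

    count≡pairs : ∀ {n} (F : Fin n → Fin n → Bool) → count F ≡ pairs F
    count≡pairs {n} F = trans (sum-allFin λ u → ListAction.sum (List.map (λ v → ⟦ F u v ⟧) (List.allFin n)))
                          (sum-cong-≗ λ u → sum-allFin λ v → ⟦ F u v ⟧)

  monotone-ends : ∀ {k} (f : Fin (suc k) → ℕ) → (∀ i → f (inject₁ i) ≤ f (suc i)) → f zero ≤ f (fromℕ k)
  monotone-ends {zero}  f le = ≤-refl
  monotone-ends {suc k} f le = ≤-trans (le zero) (monotone-ends (f ∘ suc) (le ∘ suc))

  -- Ranks do not fall from the first vertex to the last, but the closing edge would need them to
  -- rise again.
  ranked⇒acyclic : ∀ {n} {E : Rel n} (r : Fin n → ℕ) → (∀ u v → T (E u v) → r u < r v) → Acyclic E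
  ranked⇒acyclic r increasing ℓ (k , _ , _ , v , _ , steps , last) =
    <⇒≱ (increasing _ _ last) (monotone-ends (r ∘ v) λ i → <⇒≤ (increasing _ _ (steps i)))

  -- The minimum β(G) exists only up to double negation, which is enough for a decidable P.
  beta-transfer : ∀ {n} (G : Digraph n) (P : ℕ → Set) → (∀ {x y} → x ≤ y → P x → P y) → (∀ x → Dec (P x)) →
    (∀ b → IsBeta G b → P b) → ∀ {β} → Fb (adj G) (λ _ → true) β → P β
  beta-transfer {n} G P mono P? holds {β} (r , le) with P? β
  ... | yes p = p
  ... | no ¬p = ⊥-elim (no-solution (count F) (F , λ u v p → proj₁ (∧-elim {adj G u v} p)) ≤-refl F-acyclic
                  (≤-trans (≤-reflexive (count≡pairs F)) le))
    where
    F : Fin n → Fin n → Bool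
    F u v = adj G u v ∧ (r v ≤ᵇ r u)
    F-acyclic : Acyclic (delete (adj G) F)
    F-acyclic = ranked⇒acyclic r λ u v p → let (e , kept) = ∧-elim {adj G u v} p in
      ≰⇒> λ back → not-elim kept (∧-intro e (≤⇒≤ᵇ back))
    -- Descent on the size: if F is minimum, P holds at its size and so at β; otherwise a strictly
    -- smaller feedback arc set replaces it.
    no-solution : ∀ fuel (F : EdgeSubset G) → count (proj₁ F) ≤ fuel → Acyclic (delete (adj G) (proj₁ F)) → ¬ count (proj₁ F) ≤ β
    no-solution fuel F F≤ acyclic F≤β = ¬p (mono F≤β (holds (count (proj₁ F)) ((F , refl , acyclic) , minimal fuel F≤)))
      where
      minimal : ∀ fuel → count (proj₁ F) ≤ fuel → ∀ F′ → Acyclic (delete (adj G) (proj₁ F′)) → count (proj₁ F) ≤ count (proj₁ F′)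
      minimal zero       le F′ _        = ≤-trans le z≤n
      minimal (suc fuel) le F′ acyclic′ = ≮⇒≥ λ lt →
        no-solution fuel F′ (≤-pred (≤-trans lt le)) acyclic′ (≤-trans (<⇒≤ lt) F≤β)

  -- Choice of parameters

  last-below : ∀ {P : ℕ → Set} → (∀ x → Dec (P x)) → ∀ fuel i → P i → ¬ P (fuel + i) → ∃ λ k → i ≤ k × P k × ¬ P (suc k)
  last-below P? zero i p ¬p = ⊥-elim (¬p p)
  last-below {P} P? (suc fuel) i p ¬p with P? (suc i)
  ... | no ¬q = i , ≤-refl , p , ¬q
  ... | yes q = let (k , le , pk , ¬pk) = last-below P? fuel (suc i) q (¬p ∘ subst P (+-suc fuel i)) in k , <⇒≤ le , pk , ¬pk

  -- With θ = a/B the bounds read (2k)²θ ≤ 25 and 5/(2k²) ≤ 9θ/10: the window is short enough, and a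
  -- tenth of θ is left for other costs. The largest k ≥ 2 satisfying the first satisfies the
  -- second, since (k + 1)² ≤ 9k²/4.
  window : ∀ a B → 1 ≤ a → a < B → ∃ λ k → 2 ≤ k × 4 * (k * k) * a ≤ 25 * B × 25 * B ≤ 9 * (k * k) * a
  window a B a≥1 a<B = finish (last-below {P} (λ k → 4 * (k * k) * a ≤? 25 * B) (25 * B) 2 two-fits too-big)
    where
    open ≤-Reasoning
    P : ℕ → Set
    P k = 4 * (k * k) * a ≤ 25 * B
    two-fits : 16 * a ≤ 25 * B
    two-fits = *-mono-≤ (m≤m+n 16 9) (<⇒≤ a<B)
    too-big : ¬ P (25 * B + 2)
    too-big = <⇒≱ (begin-strict
      25 * B                                    <⟨ m<m+n (25 * B) (s≤s z≤n) ⟩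
      25 * B + 2                                ≤⟨ m≤m*n (25 * B + 2) (25 * B + 2) {{>-nonZero (≤-trans (s≤s z≤n) (m≤n+m 2 (25 * B)))}} ⟩
      (25 * B + 2) * (25 * B + 2)               ≤⟨ m≤n*m _ 4 ⟩
      4 * ((25 * B + 2) * (25 * B + 2))         ≤⟨ m≤m*n _ a {{>-nonZero a≥1}} ⟩
      4 * ((25 * B + 2) * (25 * B + 2)) * a ∎)
    square : ∀ k → 2 ≤ k → 4 * (suc k * suc k) ≤ 9 * (k * k)
    square k k≥2 = subst (λ k → 4 * (suc k * suc k) ≤ 9 * (k * k)) (m+[n∸m]≡n k≥2)
      (≤-trans (m≤m+n _ (12 * j + 5 * (j * j))) (≤-reflexive (id₁ j)))
      where
      j = k ∸ 2
      id₁ : ∀ j → 4 * ((3 + j) * (3 + j)) + (12 * j + 5 * (j * j)) ≡ 9 * ((2 + j) * (2 + j))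
      id₁ = solve-∀
    finish : (∃ λ k → 2 ≤ k × P k × ¬ P (suc k)) → ∃ λ k → 2 ≤ k × 4 * (k * k) * a ≤ 25 * B × 25 * B ≤ 9 * (k * k) * a
    finish (k , k≥2 , p , ¬p) = k , k≥2 , p , ≤-trans (<⇒≤ (≰⇒> ¬p)) (*-monoˡ-≤ a (square k k≥2))

  -- The factor `2 * D + 11` is an R for which (1 - 1/R)θn exceeds both (1 - 1/D)θn and 9θn/10.
  scale : ℕ → ℕ → ℕ
  scale B D = 5 * (B * (2 * D + 11))

  -- Here θ = a/B and 1 - δ = e/D; the budget c is about (1 - 1/R) θ n with R = 2D + 11, and q = 5BR.
  module Budget {a B e D k} (a≥1 : 1 ≤ a) (B≥1 : 1 ≤ B) (e<D : e < D) (25B≤9k²a : 25 * B ≤ 9 * (k * k) * a) (C : ℕ) where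

    open ≤-Reasoning

    R BR q n₀ : ℕ
    R  = 2 * D + 11
    BR = B * R
    q  = scale B D
    -- The first summand serves `short-budget`, the second `path-budget`; the 1 makes n positive.
    n₀ = 18 * (k * k) * R * (C + 1) + D * BR * (C + 1) + 1

    D≥1 : 1 ≤ D
    D≥1 = ≤-trans (s≤s z≤n) e<D

    BR≥1 : 1 ≤ BR
    BR≥1 = *-mono-≤ B≥1 (≤-trans (s≤s z≤n) (m≤n+m 11 (2 * D)))

    q≥1 : 1 ≤ q
    q≥1 = *-mono-≤ {1} {5} (s≤s z≤n) BR≥1

    instance
      BR≢0 = >-nonZero BR≥1
      D≢0  = >-nonZero D≥1

    module _ {n} (large : n₀ ≤ n) where

      z c : ℕ
      z = a * (2 * D + 10) * n
      c = z / BR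

      n≥1 : 1 ≤ n
      n≥1 = ≤-trans (m≤n+m 1 _) large

      n-large₁ : 18 * (k * k) * R * (C + 1) ≤ n
      n-large₁ = ≤-trans (≤-trans (m≤m+n _ (D * BR * (C + 1))) (m≤m+n _ 1)) large

      n-large₂ : D * BR * (C + 1) ≤ n
      n-large₂ = ≤-trans (≤-trans (m≤n+m _ (18 * (k * k) * R * (C + 1))) (m≤m+n _ 1)) large

      c*BR≤z : c * BR ≤ z
      c*BR≤z = ≤-trans (m≤n+m (c * BR) (z % BR)) (≤-reflexive (sym (m≡m%n+[m/n]*n z BR)))

      z≤c*BR+BR : z ≤ c * BR + BR
      z≤c*BR+BR = ≤-trans (≤-reflexive (trans (m≡m%n+[m/n]*n z BR) (+-comm (z % BR) (c * BR)))) (+-monoʳ-≤ (c * BR) (<⇒≤ (m%n<n z BR)))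

      -- As e < D, m is at most (1 - 1/D)θn; the gap of (1/D - 1/R)θn up to c covers C, the rounding
      -- of c and 2n/q.
      path-budget : ∀ m → D * B * m ≤ e * a * n → q * (m + C) + 2 * n ≤ q * c
      path-budget m hm = *-cancelʳ-≤ _ _ (D * BR) {{m*n≢0 D BR}} (+-cancelʳ-≤ (q * D * BR) _ _ (+-cancelʳ-≤ (q * D * a * n) _ _ (begin
        (q * (m + C) + 2 * n) * (D * BR) + q * D * BR + q * D * a * n   ≡⟨ id₁ q m C n D B R a ⟩
        q * R * (D * B * m) + (q * (D * BR * (C + 1)) + 2 * BR * D * n + q * D * a * n) ≤⟨ +-mono-≤ (*-monoʳ-≤ (q * R) hm) slack ⟩
        q * R * (e * a * n) + q * R * a * n                             ≡⟨ id₂ q R e a n ⟩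
        q * R * (suc e * (a * n))                                       ≤⟨ *-monoʳ-≤ (q * R) (*-monoˡ-≤ (a * n) e<D) ⟩
        q * R * (D * (a * n))                                           ≡⟨ id₃ q D a n ⟩
        q * D * z + q * D * a * n                                       ≤⟨ +-monoˡ-≤ (q * D * a * n) (*-monoʳ-≤ (q * D) z≤c*BR+BR) ⟩
        q * D * (c * BR + BR) + q * D * a * n                           ≡⟨ cong (_+ q * D * a * n) (id₄ q D c BR) ⟩
        q * c * (D * BR) + q * D * BR + q * D * a * n ∎)))
        where
        id₁ : ∀ q m C n D B R a → (q * (m + C) + 2 * n) * (D * (B * R)) + q * D * (B * R) + q * D * a * n ≡
          q * R * (D * B * m) + (q * (D * (B * R) * (C + 1)) + 2 * (B * R) * D * n + q * D * a * n)
        id₁ = solve-∀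
        id₂ : ∀ q R e a n → q * R * (e * a * n) + q * R * a * n ≡ q * R * (suc e * (a * n))
        id₂ = solve-∀
        id₃ : ∀ q D a n → q * (2 * D + 11) * (D * (a * n)) ≡ q * D * (a * (2 * D + 10) * n) + q * D * a * n
        id₃ = solve-∀
        id₄ : ∀ q D c x → q * D * (c * x + x) ≡ q * c * (D * x) + q * D * x
        id₄ = solve-∀
        slack : q * (D * BR * (C + 1)) + 2 * BR * D * n + q * D * a * n ≤ q * R * a * n
        slack = begin
          q * (D * BR * (C + 1)) + 2 * BR * D * n + q * D * a * n  ≤⟨ +-monoˡ-≤ (q * D * a * n) (+-mono-≤ (*-monoʳ-≤ q n-large₂) (*-monoˡ-≤ n (*-monoˡ-≤ D (*-monoˡ-≤ BR (m≤m+n 2 3))))) ⟩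
          q * n + q * D * n + q * D * a * n                        ≤⟨ +-monoˡ-≤ (q * D * a * n) (+-mono-≤ (m≤m*n (q * n) a {{>-nonZero a≥1}}) (m≤m*n (q * D * n) a {{>-nonZero a≥1}})) ⟩
          q * n * a + q * D * n * a + q * D * a * n                ≤⟨ m≤m+n _ (10 * (q * n * a)) ⟩
          q * n * a + q * D * n * a + q * D * a * n + 10 * (q * n * a) ≡⟨ id₅ q D a n ⟩
          q * R * a * n ∎
          where
          id₅ : ∀ q D a n → q * n * a + q * D * n * a + q * D * a * n + 10 * (q * n * a) ≡ q * (2 * D + 11) * a * n
          id₅ = solve-∀

      -- 5n/(2k²) is at most 9θn/10, whereas c is about (1 - 1/R)θn with R ≥ 11.
      short-budget : 2 * (k * k) * C + 5 * n ≤ 2 * (k * k) * c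
      short-budget = *-cancelʳ-≤ _ _ (9 * BR) {{m*n≢0 9 BR}} (+-cancelʳ-≤ (18 * (k * k) * BR) _ _ (begin
        (2 * (k * k) * C + 5 * n) * (9 * BR) + 18 * (k * k) * BR       ≡⟨ id₁ (k * k) C n D B ⟩
        B * (18 * (k * k) * R * (C + 1)) + (90 * D + 495) * (B * n)    ≤⟨ +-monoˡ-≤ _ (*-monoʳ-≤ B n-large₁) ⟩
        B * n + (90 * D + 495) * (B * n)                               ≤⟨ m≤m+n _ ((10 * D + 4) * (B * n)) ⟩
        B * n + (90 * D + 495) * (B * n) + (10 * D + 4) * (B * n)      ≡⟨ id₂ D B n ⟩
        2 * (25 * B) * ((2 * D + 10) * n)                              ≤⟨ *-monoˡ-≤ ((2 * D + 10) * n) (*-monoʳ-≤ 2 25B≤9k²a) ⟩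
        2 * (9 * (k * k) * a) * ((2 * D + 10) * n)                     ≡⟨ id₃ (k * k) a D n ⟩
        18 * (k * k) * z                                               ≤⟨ *-monoʳ-≤ (18 * (k * k)) z≤c*BR+BR ⟩
        18 * (k * k) * (c * BR + BR)                                   ≡⟨ id₄ (k * k) c BR ⟩
        2 * (k * k) * c * (9 * BR) + 18 * (k * k) * BR ∎))
        where
        id₁ : ∀ K C n D B → (2 * K * C + 5 * n) * (9 * (B * (2 * D + 11))) + 18 * K * (B * (2 * D + 11)) ≡
          B * (18 * K * (2 * D + 11) * (C + 1)) + (90 * D + 495) * (B * n)
        id₁ = solve-∀
        id₂ : ∀ D B n → B * n + (90 * D + 495) * (B * n) + (10 * D + 4) * (B * n) ≡ 2 * (25 * B) * ((2 * D + 10) * n)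
        id₂ = solve-∀
        id₃ : ∀ K a D n → 2 * (9 * K * a) * ((2 * D + 10) * n) ≡ 18 * K * (a * (2 * D + 10) * n)
        id₃ = solve-∀
        id₄ : ∀ K c x → 18 * K * (c * x + x) ≡ 2 * K * c * (9 * x) + 18 * K * x
        id₄ = solve-∀

      -- θn² exceeds cn by at least θn²/R = 5an²/q, which is more than the cost 5n²/(2q²) of the
      -- outer cuts.
      over-budget : ∀ β → a * (n * n) ≤ β * B → ¬ 2 * (q * q) * β ≤ 2 * (q * q) * (c * n) + 5 * (n * n)
      over-budget β hβ le = <⇒≱ tight (+-cancelˡ-≤ (2 * (q * q) * n * z) _ _ (begin
        2 * (q * q) * n * z + 2 * (q * q) * (a * (n * n))   ≡⟨ id₁ (q * q) n a D ⟩
        2 * (q * q) * R * (a * (n * n))                     ≤⟨ *-monoʳ-≤ (2 * (q * q) * R) hβ ⟩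
        2 * (q * q) * R * (β * B)                           ≡⟨ id₂ (q * q) R β B ⟩
        2 * (q * q) * β * BR                                ≤⟨ *-monoˡ-≤ BR le ⟩
        (2 * (q * q) * (c * n) + 5 * (n * n)) * BR          ≡⟨ id₃ (q * q) c n BR ⟩
        2 * (q * q) * n * (c * BR) + q * (n * n)            ≤⟨ +-monoˡ-≤ (q * (n * n)) (*-monoʳ-≤ (2 * (q * q) * n) c*BR≤z) ⟩
        2 * (q * q) * n * z + q * (n * n) ∎))
        where
        id₁ : ∀ Q n a D → 2 * Q * n * (a * (2 * D + 10) * n) + 2 * Q * (a * (n * n)) ≡ 2 * Q * (2 * D + 11) * (a * (n * n))
        id₁ = solve-∀
        id₂ : ∀ Q R β B → 2 * Q * R * (β * B) ≡ 2 * Q * β * (B * R)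
        id₂ = solve-∀
        id₃ : ∀ Q c n x → (2 * Q * (c * n) + 5 * (n * n)) * x ≡ 2 * Q * n * (c * x) + 5 * x * (n * n)
        id₃ = solve-∀
        tight : q * (n * n) < 2 * (q * q) * (a * (n * n))
        tight = begin-strict
          q * (n * n)                    <⟨ *-monoˡ-< (n * n) {{m*n≢0 n n {{>-nonZero n≥1}} {{>-nonZero n≥1}}}} (m<m+n q {q + 0} (≤-trans q≥1 (m≤m+n q 0))) ⟩
          2 * q * (n * n)                ≤⟨ *-mono-≤ (*-monoʳ-≤ 2 (m≤m*n q q {{>-nonZero q≥1}})) (m≤n*m (n * n) a {{>-nonZero a≥1}}) ⟩
          2 * (q * q) * (a * (n * n)) ∎

open Combinatorics using (Fb; SmallFeedback; NearCycle; Dichotomy; near-cycle-or-small-feedback; beta-transfer; scale; window; module Budget)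
open import Data.Nat using (ℕ; _≥_; _∸_) renaming (_≤_ to _≤ℕ_)
open import Data.Rational using (ℚ; _<_; _≤_; _*_; _+_; _-_; 0ℚ; 1ℚ)
open import Data.Rational using (-_; mkℚ; *≤*; toℚᵘ; NonNegative; Positive; nonNegative)
open import Data.Rational.Solver using (module +-*-Solver)
open import Data.Rational.Unnormalised using (*≡*)
import Data.Integer as ℤ
import Data.Integer.Properties as ℤₚ
import Data.Nat as ℕ
import Data.Nat.Coprimality as Coprimality
import Data.Nat.Properties as ℕₚ
import Data.Rational as ℚ
import Data.Rational.Properties as ℚₚ
import Data.Rational.Unnormalised.Properties as ℚᵘₚ

-- Translation from ℚ to ℕ

-- k/1 is in lowest terms. On this explicit form products and comparisons reduce to integers.
ℕ→ℚ-mk : ∀ k → ℕ→ℚ k ≡ mkℚ (ℤ.+ k) 0 (Coprimality.sym (Coprimality.1-coprimeTo k))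
ℕ→ℚ-mk k = ℚₚ.normalize-coprime (Coprimality.sym (Coprimality.1-coprimeTo k))

ℕ→ℚ-* : ∀ x y → ℕ→ℚ (x ℕ.* y) ≡ ℕ→ℚ x * ℕ→ℚ y
ℕ→ℚ-* x y = trans (cong (ℚ._/ 1) (ℤₚ.pos-* x y)) (sym (cong₂ _*_ (ℕ→ℚ-mk x) (ℕ→ℚ-mk y)))

ℕ→ℚ-cancel-≤ : ∀ {x y} → ℕ→ℚ x ≤ ℕ→ℚ y → x ≤ℕ y
ℕ→ℚ-cancel-≤ {x} {y} le = ℤₚ.drop‿+≤+ (ℤₚ.*-cancelʳ-≤-pos (ℤ.+ x) (ℤ.+ y) (ℤ.+ 1)
  (ℚₚ.drop-*≤* (subst₂ _≤_ (ℕ→ℚ-mk x) (ℕ→ℚ-mk y) le)))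

ℕ→ℚ-mono-≤ : ∀ {x y} → x ≤ℕ y → ℕ→ℚ x ≤ ℕ→ℚ y
ℕ→ℚ-mono-≤ {x} {y} le = subst₂ _≤_ (sym (ℕ→ℚ-mk x)) (sym (ℕ→ℚ-mk y)) (*≤* (ℤₚ.*-monoʳ-≤-nonNeg (ℤ.+ 1) (ℤ.+≤+ le)))

ℕ→ℚ-nonNeg : ∀ k → NonNegative (ℕ→ℚ k)
ℕ→ℚ-nonNeg k = nonNegative (ℕ→ℚ-mono-≤ {0} {k} z≤n)

ℕ→ℚ-pos : ∀ {k} → 1 ≤ℕ k → Positive (ℕ→ℚ k)
ℕ→ℚ-pos {suc k} _ = subst Positive (sym (ℕ→ℚ-mk (suc k))) _

fraction : ∀ θ → 0ℚ < θ → θ < 1ℚ → ∃ λ a → ∃ λ B → 1 ≤ℕ a × a ℕ.< B × θ * ℕ→ℚ B ≡ ℕ→ℚ a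
fraction (mkℚ (ℤ.+ 0) d c) 0<θ θ<1 = ⊥-elim (ℤₚ.<-irrefl refl (ℚₚ.drop-*<* 0<θ))
fraction (mkℚ ℤ.-[1+ x ] d c) 0<θ θ<1 with ℚₚ.drop-*<* 0<θ
... | ()
fraction θ@(mkℚ (ℤ.+ suc x) d c) 0<θ θ<1 = suc x , suc d , s≤s z≤n , below , ℚₚ.toℚᵘ-injective (ℚᵘₚ.≃-trans
  (ℚᵘₚ.≃-trans (ℚₚ.toℚᵘ-homo-* θ (ℕ→ℚ (suc d))) (ℚᵘₚ.*-congˡ {toℚᵘ θ} (ℚᵘₚ.≃-reflexive (cong toℚᵘ (ℕ→ℚ-mk (suc d))))))
  (ℚᵘₚ.≃-trans (*≡* (trans (ℤₚ.*-identityʳ _) (cong (λ y → ℤ.+ suc x ℤ.* ℤ.+ y) (sym (ℕₚ.*-identityʳ (suc d))))))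
    (ℚᵘₚ.≃-reflexive (cong toℚᵘ (sym (ℕ→ℚ-mk (suc x)))))))
  where
  below : suc x ℕ.< suc d
  below = ℤₚ.drop‿+<+ (subst₂ ℤ._<_ (ℤₚ.*-identityʳ _) (ℤₚ.*-identityˡ _) (ℚₚ.drop-*<* θ<1))

module _ {θ : ℚ} {a B : ℕ} (B≥1 : 1 ≤ℕ B) (θB : θ * ℕ→ℚ B ≡ ℕ→ℚ a) where

  open ℚₚ.≤-Reasoning
  open +-*-Solver

  beta-in-ℕ : ∀ {n β} → θ * (ℕ→ℚ n * ℕ→ℚ n) ≤ ℕ→ℚ β → a ℕ.* (n ℕ.* n) ≤ℕ β ℕ.* B
  beta-in-ℕ {n} {β} le = ℕ→ℚ-cancel-≤ (begin
    ℕ→ℚ (a ℕ.* (n ℕ.* n))                    ≡⟨ trans (ℕ→ℚ-* a (n ℕ.* n)) (cong₂ _*_ (sym θB) (ℕ→ℚ-* n n)) ⟩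
    θ * ℕ→ℚ B * (ℕ→ℚ n * ℕ→ℚ n)              ≡⟨ solve 3 (λ t b n → t :* b :* (n :* n) := t :* (n :* n) :* b) refl θ (ℕ→ℚ B) (ℕ→ℚ n) ⟩
    θ * (ℕ→ℚ n * ℕ→ℚ n) * ℕ→ℚ B              ≤⟨ ℚₚ.*-monoʳ-≤-nonNeg (ℕ→ℚ B) {{ℕ→ℚ-nonNeg B}} le ⟩
    ℕ→ℚ β * ℕ→ℚ B                            ≡⟨ ℕ→ℚ-* β B ⟨
    ℕ→ℚ (β ℕ.* B) ∎)

  length-in-ℕ : ∀ {ε e D m n} → ε * ℕ→ℚ D ≡ ℕ→ℚ e → ℕ→ℚ m ≤ ε * θ * ℕ→ℚ n → D ℕ.* B ℕ.* m ≤ℕ e ℕ.* a ℕ.* n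
  length-in-ℕ {ε} {e} {D} {m} {n} εD le = ℕ→ℚ-cancel-≤ (begin
    ℕ→ℚ (D ℕ.* B ℕ.* m)                      ≡⟨ ℕ→ℚ-* (D ℕ.* B) m ⟩
    ℕ→ℚ (D ℕ.* B) * ℕ→ℚ m                    ≤⟨ ℚₚ.*-monoˡ-≤-nonNeg (ℕ→ℚ (D ℕ.* B)) {{ℕ→ℚ-nonNeg (D ℕ.* B)}} le ⟩
    ℕ→ℚ (D ℕ.* B) * (ε * θ * ℕ→ℚ n)          ≡⟨ cong (_* (ε * θ * ℕ→ℚ n)) (ℕ→ℚ-* D B) ⟩
    ℕ→ℚ D * ℕ→ℚ B * (ε * θ * ℕ→ℚ n)          ≡⟨ solve 5 (λ d b ε t n → d :* b :* (ε :* t :* n) := ε :* d :* (t :* b) :* n) refl (ℕ→ℚ D) (ℕ→ℚ B) ε θ (ℕ→ℚ n) ⟩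
    ε * ℕ→ℚ D * (θ * ℕ→ℚ B) * ℕ→ℚ n          ≡⟨ cong₂ (λ x y → x * y * ℕ→ℚ n) εD θB ⟩
    ℕ→ℚ e * ℕ→ℚ a * ℕ→ℚ n                    ≡⟨ trans (ℕ→ℚ-* (e ℕ.* a) n) (cong (_* ℕ→ℚ n) (ℕ→ℚ-* e a)) ⟨
    ℕ→ℚ (e ℕ.* a ℕ.* n) ∎)

  -- Squared form of x ≤ (5 + δ)θ^(-1/2), which stays within the rationals; it passes through x²θ ≤
  -- 25 ≤ (5 + δ)².
  window-in-ℚ : ∀ {δ x} → 0ℚ < δ → x ℕ.* x ℕ.* a ≤ℕ 25 ℕ.* B → ℕ→ℚ x * ℕ→ℚ x * θ ≤ (ℕ→ℚ 5 + δ) * (ℕ→ℚ 5 + δ)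
  window-in-ℚ {δ} {x} 0<δ le = ℚₚ.≤-trans (ℚₚ.*-cancelʳ-≤-pos (ℕ→ℚ B) {{ℕ→ℚ-pos B≥1}} (begin
    ℕ→ℚ x * ℕ→ℚ x * θ * ℕ→ℚ B                ≡⟨ ℚₚ.*-assoc (ℕ→ℚ x * ℕ→ℚ x) θ (ℕ→ℚ B) ⟩
    ℕ→ℚ x * ℕ→ℚ x * (θ * ℕ→ℚ B)              ≡⟨ cong₂ _*_ (sym (ℕ→ℚ-* x x)) θB ⟩
    ℕ→ℚ (x ℕ.* x) * ℕ→ℚ a                    ≡⟨ ℕ→ℚ-* (x ℕ.* x) a ⟨
    ℕ→ℚ (x ℕ.* x ℕ.* a)                      ≤⟨ ℕ→ℚ-mono-≤ le ⟩
    ℕ→ℚ (25 ℕ.* B)                           ≡⟨ ℕ→ℚ-* 25 B ⟩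
    ℕ→ℚ 25 * ℕ→ℚ B ∎)) (begin
    ℕ→ℚ 5 * ℕ→ℚ 5                            ≤⟨ ℚₚ.*-monoʳ-≤-nonNeg (ℕ→ℚ 5) {{ℕ→ℚ-nonNeg 5}} five≤ ⟩
    (ℕ→ℚ 5 + δ) * ℕ→ℚ 5                      ≤⟨ ℚₚ.*-monoˡ-≤-nonNeg (ℕ→ℚ 5 + δ) {{nonNegative (ℚₚ.≤-trans (ℕ→ℚ-mono-≤ {0} {5} z≤n) five≤)}} five≤ ⟩
    (ℕ→ℚ 5 + δ) * (ℕ→ℚ 5 + δ) ∎)
    where
    five≤ : ℕ→ℚ 5 ≤ ℕ→ℚ 5 + δ
    five≤ = subst (_≤ ℕ→ℚ 5 + δ) (ℚₚ.+-identityʳ (ℕ→ℚ 5)) (ℚₚ.+-monoʳ-≤ (ℕ→ℚ 5) (ℚₚ.<⇒≤ 0<δ))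

-- The theorem for rational parameters

0<1-p : ∀ {p} → p < 1ℚ → 0ℚ < 1ℚ - p
0<1-p {p} p<1 = subst (_< 1ℚ - p) (ℚₚ.+-inverseʳ p) (ℚₚ.+-monoˡ-< (- p) p<1)

1-p<1 : ∀ {p} → 0ℚ < p → 1ℚ - p < 1ℚ
1-p<1 {p} 0<p = subst (1ℚ - p <_) (ℚₚ.+-identityʳ 1ℚ) (ℚₚ.+-monoʳ-< 1ℚ (ℚₚ.neg-antimono-< 0<p))

theorem1p4 : (δ θ : ℚ) → 0ℚ < δ → δ < 1ℚ → 0ℚ < θ → θ < 1ℚ →
    Σ ℕ λ n₀ → (n : ℕ) → n ≥ n₀ → (G : Digraph n) →
    ((b : ℕ) → IsBeta G b → θ * (ℕ→ℚ n * ℕ→ℚ n) ≤ ℕ→ℚ b) →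
    (m : ℕ) → ℕ→ℚ m ≤ (1ℚ - δ) * θ * ℕ→ℚ n →
    Σ ℕ λ ℓ → m ≤ℕ ℓ ×
    (ℕ→ℚ (ℓ ∸ m) * ℕ→ℚ (ℓ ∸ m) * θ ≤ (ℕ→ℚ 5 + δ) * (ℕ→ℚ 5 + δ)) ×
    HasCycle G ℓ
theorem1p4 δ θ 0<δ δ<1 0<θ θ<1 =
  let (a , B , a≥1 , a<B , θB) = fraction θ 0<θ θ<1
      (e , D , _ , e<D , εD) = fraction (1ℚ - δ) (0<1-p δ<1) (1-p<1 0<δ)
      (k , k≥2 , wide , narrow) = window a B a≥1 a<B
      -- The 0 passed to `Budget.q≥1` stands in for C, which is only obtained here; q does not
      -- depend on it.
      (C , dichotomy) = near-cycle-or-small-feedback (scale B D) k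
        (Budget.q≥1 {a} {B} {e} {D} {k} a≥1 (ℕₚ.≤-trans (s≤s z≤n) a<B) e<D narrow 0) (ℕₚ.≤-trans (s≤s z≤n) k≥2)
  in conclude {a} {B} {e} {D} {k} a≥1 a<B θB e<D εD wide narrow C dichotomy
  where
  conclude : ∀ {a B e D k} → 1 ≤ℕ a → a ℕ.< B → θ * ℕ→ℚ B ≡ ℕ→ℚ a → e ℕ.< D → (1ℚ - δ) * ℕ→ℚ D ≡ ℕ→ℚ e →
    4 ℕ.* (k ℕ.* k) ℕ.* a ≤ℕ 25 ℕ.* B → 25 ℕ.* B ≤ℕ 9 ℕ.* (k ℕ.* k) ℕ.* a →
    ∀ C → Dichotomy (scale B D) k C →
    Σ ℕ λ n₀ → (n : ℕ) → n ≥ n₀ → (G : Digraph n) →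
    ((b : ℕ) → IsBeta G b → θ * (ℕ→ℚ n * ℕ→ℚ n) ≤ ℕ→ℚ b) →
    (m : ℕ) → ℕ→ℚ m ≤ (1ℚ - δ) * θ * ℕ→ℚ n →
    Σ ℕ λ ℓ → m ≤ℕ ℓ × (ℕ→ℚ (ℓ ∸ m) * ℕ→ℚ (ℓ ∸ m) * θ ≤ (ℕ→ℚ 5 + δ) * (ℕ→ℚ 5 + δ)) × HasCycle G ℓ
  conclude {a} {B} {e} {D} {k} a≥1 a<B θB e<D εD wide narrow C dichotomy = Bud.n₀ , find
    where
    B≥1 : 1 ≤ℕ B
    B≥1 = ℕₚ.≤-trans (s≤s z≤n) a<B
    module Bud = Budget {a} {B} {e} {D} {k} a≥1 B≥1 e<D narrow C
    find : ∀ n → n ≥ Bud.n₀ → (G : Digraph n) → (∀ b → IsBeta G b → θ * (ℕ→ℚ n * ℕ→ℚ n) ≤ ℕ→ℚ b) →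
      ∀ m → ℕ→ℚ m ≤ (1ℚ - δ) * θ * ℕ→ℚ n →
      Σ ℕ λ ℓ → m ≤ℕ ℓ × (ℕ→ℚ (ℓ ∸ m) * ℕ→ℚ (ℓ ∸ m) * θ ≤ (ℕ→ℚ 5 + δ) * (ℕ→ℚ 5 + δ)) × HasCycle G ℓ
    find n large G β≥ m m≤ = [ found , impossible ]′ (dichotomy (adj G) m (Bud.c large)
        (Bud.path-budget large m (length-in-ℕ {θ} {a} {B} B≥1 θB {1ℚ - δ} {e} {D} {m} {n} εD m≤)) (Bud.short-budget large))
      where
      open ℕₚ.≤-Reasoning
      Goal : Set
      Goal = Σ ℕ λ ℓ → m ≤ℕ ℓ × (ℕ→ℚ (ℓ ∸ m) * ℕ→ℚ (ℓ ∸ m) * θ ≤ (ℕ→ℚ 5 + δ) * (ℕ→ℚ 5 + δ)) × HasCycle G ℓ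
      found : NearCycle (adj G) m (2 ℕ.* k) → Goal
      found (ℓ , m≤ℓ , near , cycle) = ℓ , m≤ℓ , window-in-ℚ {θ} {a} {B} B≥1 θB {δ} {ℓ ∸ m} 0<δ (begin
        (ℓ ∸ m) ℕ.* (ℓ ∸ m) ℕ.* a         ≤⟨ ℕₚ.*-monoˡ-≤ a (ℕₚ.*-mono-≤ near near) ⟩
        2 ℕ.* k ℕ.* (2 ℕ.* k) ℕ.* a       ≡⟨ cong (ℕ._* a) (ℕₚ.[m*n]*[o*p]≡[m*o]*[n*p] 2 k 2 k) ⟩
        4 ℕ.* (k ℕ.* k) ℕ.* a             ≤⟨ wide ⟩
        25 ℕ.* B ∎) , cycle
      -- The hypothesis on the minimum passes to every ranking because the inequality in b is
      -- decidable and monotone.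
      impossible : (∃ λ β → Fb (adj G) (λ _ → true) β × SmallFeedback (scale B D) (Bud.c large) n β) → Goal
      impossible (β , fb , le) = ⊥-elim (Bud.over-budget large β (beta-in-ℕ {θ} {a} {B} B≥1 θB {n} {β}
        (beta-transfer G (λ b → θ * (ℕ→ℚ n * ℕ→ℚ n) ≤ ℕ→ℚ b) (λ x≤y p → ℚₚ.≤-trans p (ℕ→ℚ-mono-≤ x≤y))
          (λ b → θ * (ℕ→ℚ n * ℕ→ℚ n) ℚₚ.≤? ℕ→ℚ b) β≥ fb)) le)
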